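{- Let $\lambda$ be a partition of $n$, let $S$ be a filling of $\lambda$ with nonnegative integers, let $T\in\mathrm{SYT}(\lambda)$, and let $P$ be a $T$-snaking. Then the coefficient of the monomial $\mathbf{x}_P^S$ in $F_T^S$ is $$\pm\,|H(S)|\cdot\sum_{\tau\in A(\pi\cdot S)}(-1)^\tau,$$ where $\pi$ is the row permutation (of boxes) that returns each entry of $P$ to its original column in $T$.
   Context: Young diagrams are in French notation (the first, largest part is the bottom row). $\mathrm{SYT}(\lambda)$ is the set of standard Young tableaux of shape $\lambda$ (entries $1,\dots,n$, increasing along rows and up columns). $\mathfrak S_n$ acts on $\mathbb{C}[x_1,\dots,x_n]$ by $\sigma x_i=x_{\sigma(i)}$. $\mathcal R(T),\mathcal C(T)\subseteq\mathfrak S_n$ are the subgroups preserving the set of entries of each row, respectively column, of $T$, and $\varepsilon_T=\sum_{\tau\in\mathcal C(T)}\sum_{\sigma\in\mathcal R(T)}(-1)^\tau\,\tau\sigma$. For a filling $S$ by nonnegative integers and a bijective filling $P$ of $\lambda$ by $1,\dots,n$, $\mathbf{x}_P^S=\prod_{b\in\lambda}x_{P(b)}^{S(b)}$ (over boxes $b$). $F_T^S=\varepsilon_T\mathbf{x}_T^S$. A $T$-snaking is a bijective filling $P$ of $\lambda$ by $1,\dots,n$ such that whenever $i\ne j$ occur in the same column of $T$, they occur in different rows of $P$. Box action: label the boxes of $\lambda$ canonically by $1,\dots,n$, going up each column from bottom to top, columns from left to right. $\mathfrak S_n$ acts on fillings by permuting boxes: $(\pi\cdot Z)(b)=Z(\pi^{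 -1}(b))$. Row (resp. column) permutations of boxes are the $\pi\in\mathfrak S_n$ preserving the set of canonical labels in each row (resp. column) of $\lambda$. The permutation $\pi$ in the claim is the unique row permutation of boxes such that, for every $j$, the $j$-th column of $\pi\cdot P$ has the same set of entries as the $j$-th column of $T$. $H(S)$ is the group of row permutations $\rho$ of boxes with $\rho\cdot S=S$. For a filling $Z$, $A(Z)$ is the set of column permutations $\tau$ of boxes such that $\tau\cdot Z$ has the same multiset of entries as $Z$ in each row (equivalently $\tau\cdot Z=\sigma\cdot Z$ for some row permutation $\sigma$). $(-1)^\tau$ is the sign of $\tau$. -}

module Defs where

open import Algebra.Bundles using (CommutativeRing)
open import Data.Fin.Base using (Fin; zero; suc; toℕ; fromℕ<; splitAt; join; punchIn; punchOut)
import Data.Fin.Base as Fin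
import Data.Fin.Properties as Finₚ
open import Data.Fin.Permutation as Perm
  using (Permutation′; _⟨$⟩ʳ_; _⟨$⟩ˡ_; _∘ₚ_; insert; remove) renaming (_≈_ to _≈ₚ_)
open import Data.List.Base
  using (List; []; _∷_; length; lookup; map; foldr; filter; tabulate; allFin;
         cartesianProduct; cartesianProductWith)
open import Data.List.Properties using (length-map; length-tabulate; filter-notAll; filter-accept; filter-reject; ≡-dec)
open import Data.List.Membership.Propositional using (_∈_; lose)
open import Data.List.Membership.Propositional.Properties using (∈-map⁺; ∈-allFin)
open import Data.List.Relation.Unary.All using (All; [])
open import Data.List.Relation.Unary.Any as Any using (Any; here; there)
import Data.List.Relation.Unary.Any.Properties as Anyₚ
open import Data.List.Relation.Unary.AllPairs using (AllPairs; []; _∷_)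
import Data.List.Relation.Unary.Unique.Setoid.Properties as Uniqueₚ
import Data.List.Relation.Unary.Unique.Propositional.Properties as Unique≡
open import Data.List.Relation.Unary.Linked using (Linked)
open import Data.List.Relation.Binary.Permutation.Propositional
  using (_↭_; ↭-sym; ↭-trans; ↭-reflexive; ↭⇒↭ₛ)
open import Data.List.Relation.Binary.Pointwise using (Pointwise-≡⇒≡)
open import Data.List.Relation.Unary.Sorted.TotalOrder.Properties using (↗↭↗⇒≋)
import Data.List.Sort.Base as Sort
import Data.List.Sort.MergeSort as MergeSort
open import Data.Nat.Base using (ℕ; zero; suc; _≤_; _<_; _≥_; s≤s)
open import Data.Nat.ListAction using (sum)
import Data.Nat.Properties as ℕₚ
open import Data.Product using (Σ; Σ-syntax; ∃; ∃!; _×_; _,_; proj₁; proj₂; uncurry)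
open import Data.Sum.Base using (_⊎_; inj₁; inj₂; [_,_]′)
open import Function.Base using (_∘_)
open import Function.Bundles using (_↔_; _⇔_; Inverse; mk↔ₛ′; mk⇔; Equivalence)
open import Level using (Level; 0ℓ)
open import Relation.Binary.Bundles using (Setoid)
open import Relation.Binary.Definitions using (tri<; tri≈; tri>)
open import Relation.Binary.PropositionalEquality
  using (_≡_; _≢_; refl; sym; trans; cong; subst; setoid; _≗_; module ≡-Reasoning)
open import Relation.Nullary using (¬_; Dec; yes; no; contradiction)
open import Relation.Nullary.Decidable using (_×-dec_; _⊎-dec_; map′)
open import Relation.Unary using (Decidable)

private
  variable
    a p q : Level
    A : Set a
    n : ℕ

------------------------------------------------------------------------
-- Partitions and Young diagrams

record Partition (n : ℕ) : Set where
  field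
    parts      : List ℕ
    decreasing : Linked _≥_ parts
    positive   : All (0 <_) parts
    total      : sum parts ≡ n

open Partition

-- French notation: row 0 is the bottom row and has the largest part as length.
-- Rows, columns and entries are counted from 0.
record Box (μ : Partition n) : Set where
  constructor box
  field
    rowᵢ : Fin (length (parts μ))
    colᵢ : Fin (lookup (parts μ) rowᵢ)

open Box

row col : {μ : Partition n} → Box μ → ℕ
row b = toℕ (rowᵢ b)
col b = toℕ (colᵢ b)

Filling : Partition n → Set a → Set a
Filling μ A = Box μ → A

BijectiveFilling : Partition n → Set
BijectiveFilling {n} μ = Box μ ↔ Fin n

-- The box at which an entry occurs in a bijective filling.
position : {μ : Partition n} → BijectiveFilling μ → Fin n → Box μ
position = Inverse.from

record SYT (μ : Partition n) : Set where
  field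
    filling           : BijectiveFilling μ
    increasing-right  : ∀ {b b′} → row b ≡ row b′ → col b < col b′ →
                        Inverse.to filling b Fin.< Inverse.to filling b′
    increasing-upward : ∀ {b b′} → col b ≡ col b′ → row b < row b′ →
                        Inverse.to filling b Fin.< Inverse.to filling b′

IsSnaking : {μ : Partition n} → BijectiveFilling μ → BijectiveFilling μ → Set
IsSnaking T P = ∀ {i j} → i ≢ j → col (position T i) ≡ col (position T j) →
                row (position P i) ≢ row (position P j)

------------------------------------------------------------------------
-- The canonical labelling of the boxes

box-≡ : {μ : Partition n} {b b′ : Box μ} → row b ≡ row b′ → col b ≡ col b′ → b ≡ b′
box-≡ {b = box i j} {box i′ j′} r c with refl ← Finₚ.toℕ-injective r =
  cong (box i) (Finₚ.toℕ-injective c)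

-- b ≺ b′ when b comes first going up each column, columns from left to right.
_≺_ : {μ : Partition n} → Box μ → Box μ → Set
b ≺ b′ = col b < col b′ ⊎ (col b ≡ col b′ × row b < row b′)

_≺?_ : {μ : Partition n} (b b′ : Box μ) → Dec (b ≺ b′)
b ≺? b′ = (col b ℕₚ.<? col b′) ⊎-dec ((col b ℕₚ.≟ col b′) ×-dec (row b ℕₚ.<? row b′))

≺-irrefl : {μ : Partition n} {b : Box μ} → ¬ (b ≺ b)
≺-irrefl (inj₁ c<c)       = ℕₚ.<-irrefl refl c<c
≺-irrefl (inj₂ (_ , r<r)) = ℕₚ.<-irrefl refl r<r

≺-trans : {μ : Partition n} {b c d : Box μ} → b ≺ c → c ≺ d → b ≺ d
≺-trans (inj₁ p)       (inj₁ q)        = inj₁ (ℕₚ.<-trans p q)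
≺-trans (inj₁ p)       (inj₂ (q , _))  = inj₁ (subst (_ <_) q p)
≺-trans (inj₂ (p , _)) (inj₁ q)        = inj₁ (subst (_< _) (sym p) q)
≺-trans (inj₂ (p , r)) (inj₂ (q , r′)) = inj₂ (trans p q , ℕₚ.<-trans r r′)

≺-connex : {μ : Partition n} (b b′ : Box μ) → b ≺ b′ ⊎ b ≡ b′ ⊎ b′ ≺ b
≺-connex b b′ with ℕₚ.<-cmp (col b) (col b′)
... | tri< lt _ _ = inj₁ (inj₁ lt)
... | tri> _ _ gt = inj₂ (inj₂ (inj₁ gt))
... | tri≈ _ c≡ _ with ℕₚ.<-cmp (row b) (row b′)
...   | tri< lt _ _ = inj₁ (inj₂ (c≡ , lt))
...   | tri≈ _ r≡ _ = inj₂ (inj₁ (box-≡ r≡ c≡))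
...   | tri> _ _ gt = inj₂ (inj₂ (inj₂ (sym c≡ , gt)))

flatten : ∀ xs → Σ (Fin (length xs)) (Fin ∘ lookup xs) ↔ Fin (sum xs)
flatten xs = mk↔ₛ′ (to xs) (from xs) (to∘from xs) (from∘to xs)
  where
  to : ∀ xs → Σ (Fin (length xs)) (Fin ∘ lookup xs) → Fin (sum xs)
  to (x ∷ xs) (zero  , j) = join x (sum xs) (inj₁ j)
  to (x ∷ xs) (suc i , j) = join x (sum xs) (inj₂ (to xs (i , j)))

  above : ∀ {x xs} → Σ (Fin (length xs)) (Fin ∘ lookup xs) →
          Σ (Fin (length (x ∷ xs))) (Fin ∘ lookup (x ∷ xs))
  above (i , j) = suc i , j

  from : ∀ xs → Fin (sum xs) → Σ (Fin (length xs)) (Fin ∘ lookup xs)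
  from (x ∷ xs) k = [ zero ,_ , above ∘ from xs ]′ (splitAt x k)

  to∘from : ∀ xs k → to xs (from xs k) ≡ k
  to∘from (x ∷ xs) k with splitAt x k | Finₚ.join-splitAt x (sum xs) k
  ... | inj₁ j | eq = eq
  ... | inj₂ l | eq = trans (cong (join x (sum xs) ∘ inj₂) (to∘from xs l)) eq

  from∘to : ∀ xs b → from xs (to xs b) ≡ b
  from∘to (x ∷ xs) (zero , j)
    rewrite Finₚ.splitAt-join x (sum xs) (inj₁ j) = refl
  from∘to (x ∷ xs) (suc i , j)
    rewrite Finₚ.splitAt-join x (sum xs) (inj₂ (to xs (i , j)))
    = cong above (from∘to xs (i , j))

-- An auxiliary numbering of the boxes, row by row.
rowMajor : (μ : Partition n) → BijectiveFilling μ
rowMajor μ = subst (λ m → Box μ ↔ Fin m) (total μ)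
  (mk↔ₛ′ (λ b → I.to (rowᵢ b , colᵢ b)) (uncurry box ∘ I.from)
         I.strictlyInverseˡ (λ b → cong (uncurry box) (I.strictlyInverseʳ _)))
  where module I = Inverse (flatten (parts μ))

boxes : (μ : Partition n) → List (Box μ)
boxes {n} μ = map (Inverse.from (rowMajor μ)) (allFin n)

∈-boxes : {μ : Partition n} (b : Box μ) → b ∈ boxes μ
∈-boxes {μ = μ} b = subst (_∈ boxes μ) (Inverse.strictlyInverseʳ (rowMajor μ) b)
  (∈-map⁺ (Inverse.from (rowMajor μ)) (∈-allFin (Inverse.to (rowMajor μ) b)))

length-boxes : (μ : Partition n) → length (boxes μ) ≡ n
length-boxes {n} μ = trans (length-map (Inverse.from (rowMajor μ)) (allFin n)) (length-tabulate {n = n} (λ i → i))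

length-filter-mono : {P : A → Set p} {Q : A → Set q} (P? : Decidable P) (Q? : Decidable Q) →
  (∀ {x} → P x → Q x) → ∀ xs → length (filter P? xs) ≤ length (filter Q? xs)
length-filter-mono P? Q? P⊆Q [] = ℕₚ.≤-refl
length-filter-mono P? Q? P⊆Q (x ∷ xs) with ih ← length-filter-mono P? Q? P⊆Q xs | P? x | Q? x
... | yes px | yes qx = s≤s ih
... | yes px | no ¬qx = contradiction (P⊆Q px) ¬qx
... | no  _  | yes _  = ℕₚ.m≤n⇒m≤1+n ih
... | no  _  | no  _  = ih

length-filter-strict : {P : A → Set p} {Q : A → Set q} (P? : Decidable P) (Q? : Decidable Q) →
  (∀ {x} → P x → Q x) → ∀ {y xs} → y ∈ xs → ¬ P y → Q y →
  length (filter P? xs) < length (filter Q? xs)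
length-filter-strict P? Q? P⊆Q {y} {_ ∷ xs} (here refl) ¬py qy
  rewrite filter-reject P? {xs = xs} ¬py | filter-accept Q? {xs = xs} qy
  = s≤s (length-filter-mono P? Q? P⊆Q xs)
length-filter-strict P? Q? P⊆Q {y} {x ∷ xs} (there y∈) ¬py qy
  with ih ← length-filter-strict P? Q? P⊆Q y∈ ¬py qy | P? x | Q? x
... | yes px | yes qx = s≤s ih
... | yes px | no ¬qx = contradiction (P⊆Q px) ¬qx
... | no  _  | yes _  = ℕₚ.m≤n⇒m≤1+n ih
... | no  _  | no  _  = ih

Fin-injective⇒surjective : (f : Fin n → Fin n) → (∀ {i j} → f i ≡ f j → i ≡ j) →
                           ∀ k → ∃ λ i → f i ≡ k
Fin-injective⇒surjective {suc n} f inj k with Finₚ.any? (λ i → f i Finₚ.≟ k)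
... | yes found = found
... | no  none  = contradiction
  (Finₚ.injective⇒≤ {f = λ i → punchOut {i = k} (λ k≡ → none (i , sym k≡))}
    (inj ∘ Finₚ.punchOut-injective {i = k} _ _))
  ℕₚ.1+n≰n

position-injective : {μ : Partition n} (P : BijectiveFilling μ) →
                     ∀ {i j} → position P i ≡ position P j → i ≡ j
position-injective P {i} {j} eq = trans (sym (P.strictlyInverseˡ i)) (trans (cong P.to eq) (P.strictlyInverseˡ j))
  where module P = Inverse P

entry-injective : {μ : Partition n} (P : BijectiveFilling μ) →
                  ∀ {b c} → Inverse.to P b ≡ Inverse.to P c → b ≡ c
entry-injective P {b} {c} eq = trans (sym (P.strictlyInverseʳ b)) (trans (cong P.from eq) (P.strictlyInverseʳ c))
  where module P = Inverse P

Box-injective⇒surjective : {μ : Partition n} (f : Box μ → Box μ) →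
                           (∀ {b b′} → f b ≡ f b′ → b ≡ b′) → ∀ c → ∃ λ b → f b ≡ c
Box-injective⇒surjective {μ = μ} f inj c = R.from (proj₁ hit) , entry-injective (rowMajor μ) (proj₂ hit)
  where
  module R = Inverse (rowMajor μ)
  hit = Fin-injective⇒surjective (R.to ∘ f ∘ R.from)
          (position-injective (rowMajor μ) ∘ inj ∘ entry-injective (rowMajor μ)) (R.to c)

module _ {μ : Partition n} where

  rank : Box μ → ℕ
  rank b = length (filter (_≺? b) (boxes μ))

  rank<n : ∀ b → rank b < n
  rank<n b = subst (rank b <_) (length-boxes μ)
    (filter-notAll (_≺? b) (boxes μ) (lose (∈-boxes b) (≺-irrefl {b = b})))

  rank-mono : ∀ {b b′} → b ≺ b′ → rank b < rank b′
  rank-mono {b} {b′} b≺b′ =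
    length-filter-strict (_≺? b) (_≺? b′) 
      (λ {c} c≺b → ≺-trans {b = c} {b} {b′} c≺b b≺b′) (∈-boxes b) (≺-irrefl {b = b}) b≺b′

  label : Box μ → Fin n
  label b = fromℕ< (rank<n b)

  label-injective : ∀ {b b′} → label b ≡ label b′ → b ≡ b′
  label-injective {b} {b′} eq with ≺-connex b b′
  ... | inj₂ (inj₁ b≡b′) = b≡b′
  ... | inj₁ b≺b′        = contradiction (Finₚ.fromℕ<-injective _ _ _ _ eq) (ℕₚ.<⇒≢ (rank-mono {b} {b′} b≺b′))
  ... | inj₂ (inj₂ b′≺b) = contradiction (sym (Finₚ.fromℕ<-injective _ _ _ _ eq)) (ℕₚ.<⇒≢ (rank-mono {b′} {b} b′≺b))

canonical : (μ : Partition n) → BijectiveFilling μ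
canonical μ = mk↔ₛ′ label unlabel label-unlabel
  (λ b → label-injective {b = unlabel (label b)} {b′ = b} (label-unlabel (label b)))
  where
  hit : ∀ k → ∃ λ i → label (position (rowMajor μ) i) ≡ k
  hit = Fin-injective⇒surjective (λ i → label (position (rowMajor μ) i))
          (λ {i} {j} eq → position-injective (rowMajor μ) {i} {j}
            (label-injective {b = position (rowMajor μ) i} {b′ = position (rowMajor μ) j} eq))

  unlabel : Fin _ → Box μ
  unlabel k = position (rowMajor μ) (proj₁ (hit k))

  label-unlabel : ∀ k → label (unlabel k) ≡ k
  label-unlabel k = proj₂ (hit k)

------------------------------------------------------------------------
-- The symmetric group

-- The usual product, applying σ first; the library's _∘ₚ_ is diagrammatic.
infixr 9 _∙_
_∙_ : Permutation′ n → Permutation′ n → Permutation′ n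
τ ∙ σ = σ ∘ₚ τ

permutations : ∀ n → List (Permutation′ n)
permutations zero    = Perm.id ∷ []
permutations (suc n) = cartesianProductWith (insert zero) (allFin (suc n)) (permutations n)

≈ₚ-setoid : ℕ → Setoid 0ℓ 0ℓ
≈ₚ-setoid n = record
  { Carrier       = Permutation′ n
  ; _≈_           = _≈ₚ_
  ; isEquivalence = record
    { refl  = λ _ → refl
    ; sym   = λ eq i → sym (eq i)
    ; trans = λ eq eq′ i → trans (eq i) (eq′ i)
    }
  }

insert-zero-cong : ∀ {j} {π ρ : Permutation′ n} → π ≈ₚ ρ → insert zero j π ≈ₚ insert zero j ρ
insert-zero-cong         π≈ρ zero    = refl
insert-zero-cong {j = j} π≈ρ (suc k) = cong (punchIn j) (π≈ρ k)

permutations-complete : (π : Permutation′ n) → Any (π ≈ₚ_) (permutations n)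
permutations-complete {zero}  π = here λ ()
permutations-complete {suc n} π =
  Anyₚ.cartesianProductWith⁺ (insert zero)
    (λ { refl eq i → trans (sym (Perm.insert-remove zero π i))
                           (insert-zero-cong {π = remove zero π} eq i) })
    (∈-allFin (π ⟨$⟩ʳ zero))
    (permutations-complete (remove zero π))

permutations-unique : ∀ n → AllPairs (λ π ρ → ¬ (π ≈ₚ ρ)) (permutations n)
permutations-unique zero    = [] ∷ []
permutations-unique (suc n) =
  Uniqueₚ.cartesianProductWith⁺ (setoid (Fin (suc n))) (≈ₚ-setoid n) (≈ₚ-setoid (suc n))
    (insert zero)
    (λ {w} {x} {y} {z} eq → eq zero , λ k → Finₚ.punchIn-injective w _ _
      (trans (eq (suc k)) (cong (λ v → punchIn v (z ⟨$⟩ʳ k)) (sym (eq zero)))))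
    (Unique≡.allFin⁺ (suc n))
    (permutations-unique n)

inversions : Permutation′ n → ℕ
inversions {n} π = length (filter
  (λ (i , j) → (i Finₚ.<? j) ×-dec (π ⟨$⟩ʳ j Finₚ.<? π ⟨$⟩ʳ i))
  (cartesianProduct (allFin n) (allFin n)))

-- Since σ is a bijection of a finite set, mapping the entries of each row
-- into that row is the same as preserving the set of entries of each row.
PreservesRows PreservesColumns : {μ : Partition n} → BijectiveFilling μ → Permutation′ n → Set
PreservesRows    Q σ = ∀ v → row (position Q (σ ⟨$⟩ʳ v)) ≡ row (position Q v)
PreservesColumns Q σ = ∀ v → col (position Q (σ ⟨$⟩ʳ v)) ≡ col (position Q v)

preservesRows? : {μ : Partition n} (Q : BijectiveFilling μ) → Decidable (PreservesRows Q)
preservesRows? Q σ = Finₚ.all? λ v → row (position Q (σ ⟨$⟩ʳ v)) ℕₚ.≟ row (position Q v)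

preservesColumns? : {μ : Partition n} (Q : BijectiveFilling μ) → Decidable (PreservesColumns Q)
preservesColumns? Q σ = Finₚ.all? λ v → col (position Q (σ ⟨$⟩ʳ v)) ℕₚ.≟ col (position Q v)

-- Subgroups are listed without repetition; for Q = canonical μ these are the
-- row and the column permutations of boxes.
rowGroup columnGroup : {μ : Partition n} → BijectiveFilling μ → List (Permutation′ n)
rowGroup    {n} Q = filter (preservesRows? Q) (permutations n)
columnGroup {n} Q = filter (preservesColumns? Q) (permutations n)

------------------------------------------------------------------------
-- The action of permutations on the boxes of a filling

infixr 8 _•_
_•_ : {μ : Partition n} → Permutation′ n → Filling μ A → Filling μ A
_•_ {μ = μ} π Z b = Z (position (canonical μ) (π ⟨$⟩ˡ Inverse.to (canonical μ) b))

≗-dec : {μ : Partition n} (Y Z : Filling μ ℕ) → Dec (Y ≗ Z)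
≗-dec Y Z = map′ (λ eq b → eq (rowᵢ b) (colᵢ b)) (λ eq i j → eq (box i j))
  (Finₚ.all? λ i → Finₚ.all? λ j → Y (box i j) ℕₚ.≟ Z (box i j))

rowEntries : {μ : Partition n} → Filling μ A → Fin (length (parts μ)) → List A
rowEntries Z i = tabulate λ j → Z (box i j)

SameRows : {μ : Partition n} → Filling μ ℕ → Filling μ ℕ → Set
SameRows Y Z = ∀ i → rowEntries Y i ↭ rowEntries Z i

_↭?_ : (xs ys : List ℕ) → Dec (xs ↭ ys)
xs ↭? ys = map′
  (λ eq → ↭-trans (↭-sym (sort-↭ xs)) (↭-trans (↭-reflexive eq) (sort-↭ ys)))
  (λ xs↭ys → Pointwise-≡⇒≡ (↗↭↗⇒≋ ℕₚ.≤-totalOrder (sort-↗ xs) (sort-↗ ys)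
    (↭⇒↭ₛ (↭-trans (sort-↭ xs) (↭-trans xs↭ys (↭-sym (sort-↭ ys)))))))
  (≡-dec ℕₚ._≟_ (sort xs) (sort ys))
  where open Sort.SortingAlgorithm (MergeSort.mergeSort ℕₚ.≤-decTotalOrder)

sameRows? : {μ : Partition n} (Y Z : Filling μ ℕ) → Dec (SameRows Y Z)
sameRows? Y Z = Finₚ.all? λ i → rowEntries Y i ↭? rowEntries Z i

H : {μ : Partition n} → Filling μ ℕ → List (Permutation′ n)
H {μ = μ} S = filter (λ ρ → ≗-dec (ρ • S) S) (rowGroup (canonical μ))

A⟨_⟩ : {μ : Partition n} → Filling μ ℕ → List (Permutation′ n)
A⟨_⟩ {μ = μ} Z = filter (λ τ → sameRows? (τ • Z) Z) (columnGroup (canonical μ))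

------------------------------------------------------------------------
-- The row permutation returning each entry of P to its column in T

OccursInColumn : {μ : Partition n} → Filling μ A → ℕ → A → Set _
OccursInColumn {μ = μ} Z j v = Σ[ b ∈ Box μ ] col b ≡ j × Z b ≡ v

IsReturning : {μ : Partition n} (T P : BijectiveFilling μ) → Permutation′ n → Set
IsReturning {μ = μ} T P π =
  PreservesRows (canonical μ) π ×
  (∀ j v → OccursInColumn (π • Inverse.to P) j v ⇔ OccursInColumn (Inverse.to T) j v)

module _ {μ : Partition n} (T P : BijectiveFilling μ) (snaking : IsSnaking T P) where
  private
    module T = Inverse T
    module P = Inverse P
    module K = Inverse (canonical μ)

    len : Box μ → ℕ
    len b = lookup (parts μ) (rowᵢ b)

    target-col : Box μ → ℕ
    target-col b = col (T.from (P.to b))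

    snaking-≡ : ∀ {i j} → col (T.from i) ≡ col (T.from j) → row (P.from i) ≡ row (P.from j) → i ≡ j
    snaking-≡ {i} {j} c r with i Finₚ.≟ j
    ... | yes i≡j = i≡j
    ... | no  i≢j = contradiction r (snaking i≢j c)

    len-≡ : ∀ {b c} → row b ≡ row c → len b ≡ len c
    len-≡ = cong (lookup (parts μ)) ∘ Finₚ.toℕ-injective

    -- Move the entry of T in box β, when it lies in the first k columns, to
    -- its row in P: to its column in T if that row is longer than k, and to
    -- its box in P otherwise.
    module Bound (k : ℕ) where
      home : Box μ → Box μ
      home β = P.from (T.to β)

      data Moves (β : Box μ) : Box μ → Set where
        right : ∀ {γ} → k ≤ col β → γ ≡ β → Moves β γ
        short : ∀ {γ} → col β < k → len (home β) ≤ k → γ ≡ home β → Moves β γ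
        long  : ∀ {γ} → col β < k → k < len (home β) → row γ ≡ row (home β) → col γ ≡ col β →
                Moves β γ

      move : ∀ β → ∃ (Moves β)
      move β with col β ℕₚ.<? k | len (home β) ℕₚ.≤? k
      ... | no  ≮k | _     = β , right (ℕₚ.≮⇒≥ ≮k) refl
      ... | yes <k | yes s = home β , short <k s refl
      ... | yes <k | no  l =
        box (rowᵢ (home β)) (fromℕ< (ℕₚ.<-trans <k (ℕₚ.≰⇒> l))) ,
        long <k (ℕₚ.≰⇒> l) refl (Finₚ.toℕ-fromℕ< _)

      home-injective : ∀ {β β′} → home β ≡ home β′ → β ≡ β′
      home-injective = entry-injective T ∘ position-injective P

      low : ∀ {β γ} → col β < k → Moves β γ → col γ < k
      low <k (right k≤ _)        = contradiction <k (ℕₚ.≤⇒≯ k≤)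
      low _  (short {γ} _ s refl) = ℕₚ.<-≤-trans (Finₚ.toℕ<n (colᵢ γ)) s
      low <k (long _ _ _ c)      = subst (_< k) (sym c) <k

      high : ∀ {β γ} → k ≤ col γ → Moves β γ → γ ≡ β
      high k≤ (right _ eq)         = eq
      high k≤ m@(short <k _ _)  = contradiction (low <k m) (ℕₚ.≤⇒≯ k≤)
      high k≤ m@(long <k _ _ _) = contradiction (low <k m) (ℕₚ.≤⇒≯ k≤)

      Moves-injective : ∀ {β β′ γ} → Moves β γ → Moves β′ γ → β ≡ β′
      Moves-injective (right k≤ refl) m  = high k≤ m
      Moves-injective m (right k≤ refl)  = sym (high k≤ m)
      Moves-injective (short _ _ e) (short _ _ e′) = home-injective (trans (sym e) e′)
      Moves-injective {β} {β′} (short _ s refl) (long _ l r _) =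
        contradiction l (ℕₚ.≤⇒≯ (subst (_≤ k) (len-≡ {home β} {home β′} r) s))
      Moves-injective {β} {β′} (long _ l r _) (short _ s refl) =
        contradiction l (ℕₚ.≤⇒≯ (subst (_≤ k) (len-≡ {home β′} {home β} r) s))
      Moves-injective {β} {β′} (long _ _ r c) (long _ _ r′ c′) = entry-injective T (snaking-≡
        (trans (cong col (T.strictlyInverseʳ β))
          (trans (trans (sym c) c′) (sym (cong col (T.strictlyInverseʳ β′)))))
        (trans (sym r) r′))

      preimage : ∀ γ → ∃ λ β → Moves β γ
      preimage γ =
        let β , eq = Box-injective⇒surjective (proj₁ ∘ move)
              (λ {β} {β′} eq → Moves-injective (proj₂ (move β)) (subst (Moves β′) (sym eq) (proj₂ (move β′)))) γ
        in β , subst (Moves β) eq (proj₂ (move β))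

    target-col<len : ∀ b → target-col b < len b
    target-col<len b = from-preimage (proj₂ (Bound.preimage (len b) b))
      where
      from-preimage : ∀ {β} → Bound.Moves (len b) β b → target-col b < len b
      from-preimage (Bound.right k≤ refl) = contradiction (Finₚ.toℕ<n (colᵢ b)) (ℕₚ.≤⇒≯ k≤)
      from-preimage {β} (Bound.long _ l r _) =
        contradiction l (ℕₚ.≤⇒≯ (ℕₚ.≤-reflexive (sym (len-≡ {b} {Bound.home (len b) β} r))))
      from-preimage {β} (Bound.short <k _ b≡) = subst (_< len b) (sym (cong (λ b → col b)
        (trans (cong (λ c → T.from (P.to c)) b≡)
          (trans (cong T.from (P.strictlyInverseˡ (T.to β))) (T.strictlyInverseʳ β))))) <k

    target : Box μ → Box μ
    target b = box (rowᵢ b) (fromℕ< (target-col<len b))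

    col-target : ∀ b → col (target b) ≡ target-col b
    col-target b = Finₚ.toℕ-fromℕ< _

    target-injective : ∀ {b b′} → target b ≡ target b′ → b ≡ b′
    target-injective {b} {b′} eq = entry-injective P (snaking-≡
      (trans (sym (col-target b)) (trans (cong col eq) (col-target b′)))
      (trans (cong row (P.strictlyInverseʳ b))
        (trans (cong row eq) (sym (cong row (P.strictlyInverseʳ b′))))))

    source : ∀ c → ∃ λ b → target b ≡ c
    source = Box-injective⇒surjective target target-injective

    π : Permutation′ n
    π = mk↔ₛ′ (K.to ∘ target ∘ K.from) (K.to ∘ proj₁ ∘ source ∘ K.from)
      (λ v → trans (cong (K.to ∘ target) (K.strictlyInverseʳ _))
               (trans (cong K.to (proj₂ (source (K.from v)))) (K.strictlyInverseˡ v)))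
      (λ v → trans (cong K.to (target-injective
               (trans (proj₂ (source (K.from (K.to (target (K.from v)))))) (K.strictlyInverseʳ _))))
               (K.strictlyInverseˡ v))

    π-rows : PreservesRows (canonical μ) π
    π-rows v = cong row (K.strictlyInverseʳ (target (K.from v)))

    -- The box whose entry in P is moved to b.
    came-from : Permutation′ n → Box μ → Box μ
    came-from π′ b = K.from (π′ ⟨$⟩ˡ K.to b)

    target-came-from : ∀ b → target (came-from π b) ≡ b
    target-came-from b = trans (cong target (K.strictlyInverseʳ _))
      (trans (proj₂ (source (K.from (K.to b)))) (K.strictlyInverseʳ b))

    π-columns : ∀ j v → OccursInColumn (π • P.to) j v ⇔ OccursInColumn T.to j v
    π-columns j v = mk⇔
      (λ { (b , refl , refl) → T.from v ,
             trans (sym (col-target (came-from π b))) (cong col (target-came-from b)) ,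
             T.strictlyInverseˡ v })
      (λ { (c , refl , refl) → let b = P.from v in
             target b ,
             trans (col-target b) (cong col (trans (cong T.from (P.strictlyInverseˡ v)) (T.strictlyInverseʳ c))) ,
             trans (cong P.to (target-injective (target-came-from (target b)))) (P.strictlyInverseˡ v) })

    π-unique : ∀ {π′} → IsReturning T P π′ → π ≈ₚ π′
    π-unique {π′} (rows , columns) v =
      trans (cong K.to (box-≡ (sym (rows v)) (trans (col-target c) c-col))) (K.strictlyInverseˡ _)
      where
      c b : Box μ
      c = K.from v
      b = K.from (π′ ⟨$⟩ʳ v)
      entry : (π′ • P.to) b ≡ P.to c
      entry = cong (λ v → P.to (K.from v)) (trans (cong (π′ ⟨$⟩ˡ_) (K.strictlyInverseˡ _)) (Perm.inverseˡ π′))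
      column-of : OccursInColumn T.to (col b) (P.to c) → target-col c ≡ col b
      column-of (d , d-col , d-entry) =
        trans (cong (λ v → col (T.from v)) (sym d-entry))
          (trans (cong (λ e → col e) (T.strictlyInverseʳ d)) d-col)
      c-col : target-col c ≡ col b
      c-col = column-of (Equivalence.to (columns (col b) (P.to c)) (b , refl , entry))

  ∃!-returning : ∃! _≈ₚ_ (IsReturning T P)
  ∃!-returning = π , (π-rows , π-columns) , λ {π′} → π-unique {π′}

  returning : Permutation′ n
  returning = proj₁ ∃!-returning

------------------------------------------------------------------------
-- Polynomials and the action of the group algebra

-- m stands for the product of the x_v ^ m v.
Monomial : ℕ → Set
Monomial n = Fin n → ℕ

_≗?_ : (m m′ : Monomial n) → Dec (m ≗ m′)
m ≗? m′ = Finₚ.all? λ v → m v ℕₚ.≟ m′ v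

-- The monomial with x_{P(b)} raised to S(b), for every box b.
x^ : {μ : Partition n} → BijectiveFilling μ → Filling μ ℕ → Monomial n
x^ P S v = S (position P v)

-- σ sends x_i to x_{σ(i)}.
actₘ : Permutation′ n → Monomial n → Monomial n
actₘ σ m v = m (σ ⟨$⟩ˡ v)

-- Polynomials in x_0, …, x_{n-1} over an arbitrary commutative ring; ℂ is one
-- instance of R.
module Polynomials {c ℓ} (R : CommutativeRing c ℓ) where
  open CommutativeRing R
    using (Carrier; 0#; 1#; _+_; _*_; -_; semiring; +-rawMonoid)
  open import Algebra.Definitions.RawMonoid +-rawMonoid public
    using () renaming (_×_ to _·_)
  open import Algebra.Properties.Semiring.Exp semiring using (_^_)

  -- Formal linear combinations; a key may occur in several terms, whose
  -- coefficients then add up.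
  Polynomial GroupAlgebra : ℕ → Set c
  Polynomial   n = List (Carrier × Monomial n)
  GroupAlgebra n = List (Carrier × Permutation′ n)

  ∑ : List A → (A → Carrier) → Carrier
  ∑ xs f = foldr (λ x s → f x + s) 0# xs

  coefficient : Monomial n → Polynomial n → Carrier
  coefficient m f = ∑ (filter (λ t → proj₂ t ≗? m) f) proj₁

  infixr 7 _⋆_
  _⋆_ : GroupAlgebra n → Polynomial n → Polynomial n
  _⋆_ = cartesianProductWith λ (a , σ) (c , m) → a * c , actₘ σ m

  sgn : Permutation′ n → Carrier
  sgn τ = (- 1#) ^ inversions τ

  ε : {μ : Partition n} → BijectiveFilling μ → GroupAlgebra n
  ε T = cartesianProductWith (λ τ σ → sgn τ , τ ∙ σ) (columnGroup T) (rowGroup T)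

  F : {μ : Partition n} → BijectiveFilling μ → Filling μ ℕ → Polynomial n
  F T S = ε T ⋆ ((1# , x^ T S) ∷ [])

module Submission where

-- Write K for the canonical labelling of the boxes.  A term of ε_T indexed by
-- τ in C(T) and σ in R(T) contributes (-1)^τ to the coefficient of x_P^S
-- exactly when S(T⁻¹(σ⁻¹(τ⁻¹ v))) = S(P⁻¹ v) for all v.  Both groups are moved
-- to permutations of boxes.
--
-- The row permutation σ becomes σ′ = α σ α⁻¹ with α = K T⁻¹, a row permutation
-- of boxes.  The column permutation τ becomes ω = α τ⁻¹ β with β = P K⁻¹ π⁻¹;
-- because π returns the entries of P to their columns in T, the map τ ↦ ω is a
-- bijection from C(T) to the column permutations of boxes.  The equation above
-- turns into σ′ · S = ω · (π · S) (monomial-equation).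
--
-- For fixed ω the row permutations σ′ solving this equation form a coset of
-- H(S) when ω · (π · S) and S have the same multiset of entries in each row,
-- and there are none otherwise (∑-solutions).  As π is a row permutation, the
-- condition says that ω lies in A(π · S).  Finally the sign is multiplicative
-- and takes values ±1, so (-1)^τ = (-1)^α (-1)^β (-1)^ω (sgn-twist), and the
-- coefficient is (-1)^α (-1)^β |H(S)| times the sum of (-1)^ω over A(π · S)
-- (coefficient-snaking).
--
-- Multiplicativity of the sign is not immediate from its definition by counting
-- inversions.  It follows by comparing, for every pair, whether σ inverts it,
-- whether τ inverts its image, and whether τ σ inverts it (inversions-∙).

open import Defs
open import Algebra.Bundles using (CommutativeMonoid; CommutativeRing)
open import Data.Bool.Base using (Bool; true; false; not; _∧_; if_then_else_)
open import Data.Fin.Base using (Fin; toℕ)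
import Data.Fin.Base as Fin
open import Data.Fin.Permutation as Perm using (Permutation′; _⟨$⟩ʳ_; _⟨$⟩ˡ_; flip) renaming (_≈_ to _≈ₚ_)
import Data.Fin.Properties as Finₚ
open import Data.List.Base
  using (List; []; _∷_; length; lookup; map; filter; tabulate; allFin; foldr; cartesianProductWith; _++_)
open import Data.List.Membership.Propositional using (_∈_)
open import Data.List.Membership.Propositional.Properties using (∈-allFin; ∈-tabulate⁺)
open import Data.List.Membership.Propositional.Properties.WithK using (unique∧set⇒bag)
open import Data.List.Properties using (filter-≐; tabulate-cong; length-tabulate; lookup-tabulate; map-tabulate)
open import Data.List.Relation.Binary.BagAndSetEquality using (∼bag⇒↭)
open import Data.List.Relation.Binary.Permutation.Homogeneous using (onIndices)
open import Data.List.Relation.Binary.Permutation.Propositional using (_↭_; ↭⇒↭ₛ; ↭-trans; ↭-sym; ↭-reflexive)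
open import Data.List.Relation.Binary.Permutation.Propositional.Properties using (map⁺)
open import Data.List.Relation.Binary.Permutation.Setoid.Properties using (onIndices-lookup)
open import Data.List.Relation.Unary.All as All using (All; []; _∷_)
open import Data.List.Relation.Unary.All.Properties using (All¬⇒¬Any)
open import Data.List.Relation.Unary.AllPairs using (AllPairs; []; _∷_)
open import Data.List.Relation.Unary.Any as Any using (Any; here; there)
import Data.List.Relation.Unary.Unique.Propositional.Properties as Uniqueₚ
open import Data.Nat.Base as Nat using (ℕ)
import Data.Nat.Properties as ℕₚ
open import Data.Product using (Σ-syntax; ∃; ∃!; _×_; _,_; proj₁; proj₂)
open import Data.Sum.Base as Sum using (_⊎_; inj₁; inj₂)
open import Function.Base using (_∘_; id)
open import Function.Bundles using (_↔_; mk↔ₛ′; Inverse; _⇔_; mk⇔; Equivalence)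
open import Function.Construct.Composition using (_↔-∘_)
open import Function.Construct.Identity using (⇔-id)
open import Function.Construct.Symmetry using (↔-sym)
open import Level using (Level; 0ℓ)
open import Relation.Binary.Bundles using (DecSetoid; module Setoid)
open import Relation.Binary.Definitions using (tri<; tri≈; tri>)
open import Relation.Binary.PropositionalEquality as ≡ using (_≡_; _≢_; _≗_; cong; cong₂; subst)
open import Relation.Nullary using (¬_; Dec; yes; no; does; contradiction)
open import Relation.Nullary.Decidable using (_×-dec_; does-⇔; dec-true; dec-false)
open import Relation.Unary using (Decidable)

private
  variable
    a b p q : Level
    A : Set a
    B : Set b
    n : ℕ

-- Finite sums in a commutative monoid

module Sums {c ℓ} (M : CommutativeMonoid c ℓ) where
  open CommutativeMonoid M
    renaming (_∙_ to _+_; ε to 0#; ∙-cong to +-cong; ∙-congˡ to +-congˡ;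
              identityˡ to +-identityˡ; identityʳ to +-identityʳ; assoc to +-assoc)
  open import Algebra.Properties.CommutativeSemigroup commutativeSemigroup using (interchange)
  open import Relation.Binary.Reasoning.Setoid setoid

  -- For the additive monoid of a ring this is, by definition, the sum used for
  -- polynomials.
  ∑ : List A → (A → Carrier) → Carrier
  ∑ xs f = foldr (λ x s → f x + s) 0# xs

  ∑-cong : (xs : List A) {f g : A → Carrier} → (∀ x → f x ≈ g x) → ∑ xs f ≈ ∑ xs g
  ∑-cong []       f≈g = refl
  ∑-cong (x ∷ xs) f≈g = +-cong (f≈g x) (∑-cong xs f≈g)

  ∑-0# : {xs : List A} {f : A → Carrier} → All (λ x → f x ≈ 0#) xs → ∑ xs f ≈ 0#
  ∑-0# []          = refl
  ∑-0# (fx≈0 ∷ zs) = trans (+-cong fx≈0 (∑-0# zs)) (+-identityˡ 0#)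

  ∑-+ : (xs : List A) (f g : A → Carrier) → ∑ xs (λ x → f x + g x) ≈ ∑ xs f + ∑ xs g
  ∑-+ []       f g = sym (+-identityˡ 0#)
  ∑-+ (x ∷ xs) f g = trans (+-congˡ (∑-+ xs f g)) (interchange _ _ _ _)

  ∑-swap : (xs : List A) (ys : List B) (f : A → B → Carrier) →
           ∑ xs (λ x → ∑ ys (f x)) ≈ ∑ ys (λ y → ∑ xs (λ x → f x y))
  ∑-swap []       ys f = sym (∑-0# (All.universal (λ _ → refl) ys))
  ∑-swap (x ∷ xs) ys f = trans (+-congˡ (∑-swap xs ys f)) (sym (∑-+ ys (f x) _))

  ∑-++ : (xs ys : List A) (f : A → Carrier) → ∑ (xs ++ ys) f ≈ ∑ xs f + ∑ ys f
  ∑-++ []       ys f = sym (+-identityˡ _)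
  ∑-++ (x ∷ xs) ys f = trans (+-congˡ (∑-++ xs ys f)) (sym (+-assoc _ _ _))

  ∑-map : (h : A → B) (xs : List A) (f : B → Carrier) → ∑ (map h xs) f ≈ ∑ xs (f ∘ h)
  ∑-map h []       f = refl
  ∑-map h (x ∷ xs) f = +-congˡ (∑-map h xs f)

  ∑-cartesianProductWith : ∀ {d} {D : Set d} (h : A → B → D) (xs : List A) (ys : List B)
    (f : D → Carrier) → ∑ (cartesianProductWith h xs ys) f ≈ ∑ xs (λ x → ∑ ys (λ y → f (h x y)))
  ∑-cartesianProductWith h []       ys f = refl
  ∑-cartesianProductWith h (x ∷ xs) ys f = trans (∑-++ (map (h x) ys) _ f)
    (+-cong (∑-map (h x) ys f) (∑-cartesianProductWith h xs ys f))

  opaque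
    -- x if P holds and 0 otherwise.  It is opaque because unfolding it would
    -- compare decision procedures instead of the propositions they decide.
    when : {P : Set p} → Dec P → Carrier → Carrier
    when d x = if does d then x else 0#

    when-cong : {P : Set p} {Q : Set q} (P? : Dec P) (Q? : Dec Q) {x y : Carrier} →
                P ⇔ Q → x ≈ y → when P? x ≈ when Q? y
    when-cong P? Q? P⇔Q x≈y rewrite does-⇔ P⇔Q P? Q? with does Q?
    ... | true  = x≈y
    ... | false = refl

    when-true : {P : Set p} (P? : Dec P) {x : Carrier} → P → when P? x ≈ x
    when-true P? holds rewrite dec-true P? holds = refl

    when-false : {P : Set p} (P? : Dec P) {x : Carrier} → ¬ P → when P? x ≈ 0#
    when-false P? fails rewrite dec-false P? fails = refl

    ∑-filter : {P : A → Set p} (P? : Decidable P) (xs : List A) (f : A → Carrier) →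
               ∑ (filter P? xs) f ≈ ∑ xs (λ x → when (P? x) (f x))
    ∑-filter P? []       f = refl
    ∑-filter P? (x ∷ xs) f with does (P? x)
    ... | true  = +-congˡ (∑-filter P? xs f)
    ... | false = trans (∑-filter P? xs f) (sym (+-identityˡ _))

  ∑-homo : (h : Carrier → Carrier) → h 0# ≈ 0# → (∀ x y → h (x + y) ≈ h x + h y) →
           (xs : List A) (f : A → Carrier) → ∑ xs (h ∘ f) ≈ h (∑ xs f)
  ∑-homo h h-0# h-+ []       f = sym h-0#
  ∑-homo h h-0# h-+ (x ∷ xs) f = trans (+-congˡ (∑-homo h h-0# h-+ xs f)) (sym (h-+ _ _))

  module _ {s r} (X : DecSetoid s r) where
    open DecSetoid X using (_≟_) renaming (Carrier to Index; _≈_ to _∼_; sym to ∼-sym; trans to ∼-trans)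

    -- A sum over a duplicate-free list that contains x collapses to the term
    -- at x when every other term is suppressed.
    ∑-δ : {xs : List Index} → AllPairs (λ x y → ¬ x ∼ y) xs →
          (f : Index → Carrier) → (∀ {x y} → x ∼ y → f x ≈ f y) →
          ∀ {x} → Any (x ∼_) xs → ∑ xs (λ y → when (x ≟ y) (f y)) ≈ f x
    ∑-δ (y≁ ∷ _) f f-cong {x} (here {y} x∼y) = trans
      (+-cong (trans (when-true (x ≟ y) x∼y) (f-cong (∼-sym x∼y)))
              (∑-0# (All.map (λ {z} y≁z → when-false (x ≟ z) (λ x∼z → y≁z (∼-trans (∼-sym x∼y) x∼z))) y≁)))
      (+-identityʳ _)
    ∑-δ (y≁ ∷ u) f f-cong {x} (there {y} x∈) = trans
      (+-cong (when-false (x ≟ y)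
                (λ x∼y → All¬⇒¬Any y≁ (Any.map (∼-trans (∼-sym x∼y)) x∈)))
              (∑-δ u f f-cong x∈))
      (+-identityˡ _)

    -- Substitution by a bijection φ with inverse ψ, up to the equality of X.
    -- Writing f (φ x) as a sum over all y with φ x ∼ y and interchanging the two
    -- sums avoids comparing the list with its image.
    ∑-reindex : {xs : List Index} → AllPairs (λ x y → ¬ x ∼ y) xs → (∀ x → Any (x ∼_) xs) →
      (φ ψ : Index → Index) → (∀ {x y} → φ x ∼ y ⇔ ψ y ∼ x) →
      (f : Index → Carrier) → (∀ {x y} → x ∼ y → f x ≈ f y) →
      ∑ xs (f ∘ φ) ≈ ∑ xs f
    ∑-reindex {xs} unique complete φ ψ adjoint f f-cong = begin
      ∑ xs (f ∘ φ)
        ≈⟨ ∑-cong xs (λ x → sym (∑-δ unique f f-cong (complete (φ x)))) ⟩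
      ∑ xs (λ x → ∑ xs (λ y → when (φ x ≟ y) (f y)))
        ≈⟨ ∑-swap xs xs _ ⟩
      ∑ xs (λ y → ∑ xs (λ x → when (φ x ≟ y) (f y)))
        ≈⟨ ∑-cong xs (λ y → ∑-cong xs (λ x → when-cong (φ x ≟ y) (ψ y ≟ x) adjoint refl)) ⟩
      ∑ xs (λ y → ∑ xs (λ x → when (ψ y ≟ x) (f y)))
        ≈⟨ ∑-cong xs (λ y → ∑-δ unique (λ _ → f y) (λ _ → refl) (complete (ψ y))) ⟩
      ∑ xs f ∎

-- Inversions of a product of permutations

private module ℕ-Sums = Sums ℕₚ.+-0-commutativeMonoid

length-filter : {P : A → Set p} (P? : Decidable P) (xs : List A) →
                length (filter P? xs) ≡ ℕ-Sums.∑ xs (λ x → if does (P? x) then 1 else 0)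
length-filter P? []       = ≡.refl
length-filter P? (x ∷ xs) with does (P? x)
... | true  = cong Nat.suc (length-filter P? xs)
... | false = length-filter P? xs

permutation-injective : (π : Permutation′ n) → ∀ {i j} → π ⟨$⟩ʳ i ≡ π ⟨$⟩ʳ j → i ≡ j
permutation-injective π eq =
  ≡.trans (≡.sym (Perm.inverseˡ π)) (≡.trans (cong (π ⟨$⟩ˡ_) eq) (Perm.inverseˡ π))

module _ {n : ℕ} where
  open ℕ-Sums
  open Nat using (_+_)
  open import Algebra.Properties.CommutativeSemigroup ℕₚ.+-commutativeSemigroup using (interchange)

  -- The sum over all ordered pairs of indices.
  ∬ : (Fin n → Fin n → ℕ) → ℕ
  ∬ f = ∑ (allFin n) (λ i → ∑ (allFin n) (f i))

  ∬-cong : ∀ {f g} → (∀ i j → f i j ≡ g i j) → ∬ f ≡ ∬ g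
  ∬-cong f≡g = ∑-cong (allFin n) (λ i → ∑-cong (allFin n) (f≡g i))

  ∬-+ : ∀ f g → ∬ (λ i j → f i j + g i j) ≡ ∬ f + ∬ g
  ∬-+ f g = ≡.trans (∑-cong (allFin n) (λ i → ∑-+ (allFin n) (f i) (g i))) (∑-+ (allFin n) _ _)

  ∬-sym : ∀ f → ∬ (λ i j → f i j + f j i) ≡ ∬ f + ∬ f
  ∬-sym f = ≡.trans (∬-+ f _) (cong (∬ f +_) (≡.sym (∑-swap (allFin n) (allFin n) f)))

  ∬-permute : ∀ (σ : Permutation′ n) f → ∬ (λ i j → f (σ ⟨$⟩ʳ i) (σ ⟨$⟩ʳ j)) ≡ ∬ f
  ∬-permute σ f = ≡.trans (∑-cong (allFin n) (λ i → permute (f (σ ⟨$⟩ʳ i)))) (permute _)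
    where
    permute : ∀ g → ∑ (allFin n) (g ∘ (σ ⟨$⟩ʳ_)) ≡ ∑ (allFin n) g
    permute g = ∑-reindex (Finₚ.≡-decSetoid n) (Uniqueₚ.allFin⁺ n) ∈-allFin (σ ⟨$⟩ʳ_) (σ ⟨$⟩ˡ_)
      (mk⇔ (λ { ≡.refl → Perm.inverseˡ σ }) (λ { ≡.refl → Perm.inverseʳ σ })) g (cong g)

  private
    _<ᵇ_ : Fin n → Fin n → Bool
    i <ᵇ j = does (i Finₚ.<? j)

    <ᵇ-irrefl : ∀ i → i <ᵇ i ≡ false
    <ᵇ-irrefl i = dec-false (i Finₚ.<? i) (ℕₚ.<-irrefl ≡.refl)

    <ᵇ-flip : ∀ {i j} → i ≢ j → j <ᵇ i ≡ not (i <ᵇ j)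
    <ᵇ-flip {i} {j} i≢j with Finₚ.<-cmp i j
    ... | tri< lt _ _ rewrite dec-true (i Finₚ.<? j) lt = dec-false (j Finₚ.<? i) (ℕₚ.<-asym lt)
    ... | tri≈ _ eq _ = contradiction eq i≢j
    ... | tri> _ _ gt rewrite dec-true (j Finₚ.<? i) gt = cong not (≡.sym (dec-false (i Finₚ.<? j) (ℕₚ.<-asym gt)))

    count : Bool → ℕ
    count x = if x then 1 else 0

    -- 1 if i < j and π i > π j, and 0 otherwise.
    inverted : Permutation′ n → Fin n → Fin n → ℕ
    inverted π i j = count (i <ᵇ j ∧ (π ⟨$⟩ʳ j) <ᵇ (π ⟨$⟩ʳ i))

    -- 1 if i < j, σ inverts the pair, and τ puts the images back in order;
    -- 0 otherwise.
    restored : (τ σ : Permutation′ n) → Fin n → Fin n → ℕ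
    restored τ σ i j = count (i <ᵇ j ∧ (σ ⟨$⟩ʳ j) <ᵇ (σ ⟨$⟩ʳ i) ∧
                              (τ ∙ σ ⟨$⟩ʳ i) <ᵇ (τ ∙ σ ⟨$⟩ʳ j))

    inversions-∬ : ∀ π → inversions π ≡ ∬ (inverted π)
    inversions-∬ π = ≡.trans (length-filter
      (λ (i , j) → (i Finₚ.<? j) ×-dec (π ⟨$⟩ʳ j Finₚ.<? π ⟨$⟩ʳ i))
      (cartesianProductWith _,_ (allFin n) (allFin n)))
      (∑-cartesianProductWith _,_ (allFin n) (allFin n) _)

    -- For a pair i, j, regardless of order: 1 if τ σ inverts it, plus 2 if σ
    -- inverts it and τ restores it, equals 1 if τ inverts its image under σ, plus
    -- 1 if σ inverts it.
    pointwise : ∀ τ σ i j →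
      (inverted (τ ∙ σ) i j + inverted (τ ∙ σ) j i) +
      ((restored τ σ i j + restored τ σ j i) + (restored τ σ i j + restored τ σ j i)) ≡
      (inverted τ (σ ⟨$⟩ʳ i) (σ ⟨$⟩ʳ j) + inverted τ (σ ⟨$⟩ʳ j) (σ ⟨$⟩ʳ i)) +
      (inverted σ i j + inverted σ j i)
    pointwise τ σ i j with i Finₚ.≟ j
    ... | yes ≡.refl
      rewrite <ᵇ-irrefl i | <ᵇ-irrefl (σ ⟨$⟩ʳ i) = ≡.refl
    ... | no i≢j
      rewrite <ᵇ-flip i≢j | <ᵇ-flip (λ eq → i≢j (permutation-injective σ eq))
            | <ᵇ-flip (λ eq → i≢j (permutation-injective (τ ∙ σ) eq))
      -- Once the reversed comparisons are negations, three booleans remain.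
      with i <ᵇ j | (σ ⟨$⟩ʳ i) <ᵇ (σ ⟨$⟩ʳ j) | (τ ∙ σ ⟨$⟩ʳ i) <ᵇ (τ ∙ σ ⟨$⟩ʳ j)
    ... | true  | true  | true  = ≡.refl
    ... | true  | true  | false = ≡.refl
    ... | true  | false | true  = ≡.refl
    ... | true  | false | false = ≡.refl
    ... | false | true  | true  = ≡.refl
    ... | false | true  | false = ≡.refl
    ... | false | false | true  = ≡.refl
    ... | false | false | false = ≡.refl

  -- Inversion numbers are additive up to an even number, twice the number of
  -- pairs that σ inverts and τ restores.  Summing over all ordered pairs, so that
  -- σ merely permutes the terms, counts everything twice; the final step halves.
  inversions-∙ : ∀ τ σ → ∃ λ k → inversions (τ ∙ σ) + (k + k) ≡ inversions τ + inversions σ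
  inversions-∙ τ σ = k , halve (begin
    (inversions (τ ∙ σ) + (k + k)) + (inversions (τ ∙ σ) + (k + k))
      ≡⟨ interchange (inversions (τ ∙ σ)) _ _ _ ⟩
    (inversions (τ ∙ σ) + inversions (τ ∙ σ)) + ((k + k) + (k + k))
      ≡⟨ cong₂ _+_ (twice (τ ∙ σ)) (≡.sym restored-twice) ⟩
    ∬ (λ i j → inverted (τ ∙ σ) i j + inverted (τ ∙ σ) j i) +
    ∬ (λ i j → (restored τ σ i j + restored τ σ j i) + (restored τ σ i j + restored τ σ j i))
      ≡⟨ ∬-+ _ _ ⟨
    ∬ _
      ≡⟨ ∬-cong (pointwise τ σ) ⟩
    ∬ _
      ≡⟨ ∬-+ _ _ ⟩
    ∬ (λ i j → inverted τ (σ ⟨$⟩ʳ i) (σ ⟨$⟩ʳ j) + inverted τ (σ ⟨$⟩ʳ j) (σ ⟨$⟩ʳ i)) +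
    ∬ (λ i j → inverted σ i j + inverted σ j i)
      ≡⟨ cong₂ _+_ (≡.trans (∬-permute σ (λ i j → inverted τ i j + inverted τ j i)) (≡.sym (twice τ)))
                   (≡.sym (twice σ)) ⟩
    (inversions τ + inversions τ) + (inversions σ + inversions σ)
      ≡⟨ interchange (inversions τ) _ _ _ ⟩
    (inversions τ + inversions σ) + (inversions τ + inversions σ) ∎)
    where
    open ≡.≡-Reasoning
    k = ∬ (restored τ σ)

    twice : ∀ π → inversions π + inversions π ≡ ∬ (λ i j → inverted π i j + inverted π j i)
    twice π = ≡.trans (cong₂ _+_ (inversions-∬ π) (inversions-∬ π)) (≡.sym (∬-sym (inverted π)))

    restored-twice : ∬ (λ i j → (restored τ σ i j + restored τ σ j i) +
                                (restored τ σ i j + restored τ σ j i)) ≡ (k + k) + (k + k)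
    restored-twice = ≡.trans (∬-+ _ _) (cong₂ _+_ (∬-sym (restored τ σ)) (∬-sym (restored τ σ)))

    halve : ∀ {m n} → m + m ≡ n + n → m ≡ n
    halve {m} {n} eq = ℕₚ.*-cancelˡ-≡ m n 2
      (≡.trans (cong (m +_) (ℕₚ.+-identityʳ m)) (≡.trans eq (≡.sym (cong (n +_) (ℕₚ.+-identityʳ n)))))

  inversions-cong : ∀ {π ρ} → π ≈ₚ ρ → inversions π ≡ inversions ρ
  inversions-cong {π} {ρ} π≈ρ = ≡.trans (inversions-∬ π) (≡.trans
    (∬-cong (λ i j → cong₂ (λ x y → count (i <ᵇ j ∧ x <ᵇ y)) (π≈ρ j) (π≈ρ i)))
    (≡.sym (inversions-∬ ρ)))

flip-cong : {π ρ : Permutation′ n} → π ≈ₚ ρ → flip π ≈ₚ flip ρ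
flip-cong {π = π} {ρ} π≈ρ i = permutation-injective π
  (≡.trans (Perm.inverseʳ π) (≡.sym (≡.trans (π≈ρ _) (Perm.inverseʳ ρ))))

-- The sign of a permutation

module Signs {c ℓ} (R : CommutativeRing c ℓ) where
  open CommutativeRing R
  open Polynomials R using (sgn)
  open import Algebra.Properties.Semiring.Exp semiring using (_^_; ^-homo-*; ^-congʳ)
  open import Algebra.Properties.Ring ring using (-1*x≈-x; -‿involutive)
  open import Relation.Binary.Reasoning.Setoid setoid

  -1^-even : ∀ k → (- 1#) ^ (k Nat.+ k) ≈ 1#
  -1^-even Nat.zero    = refl
  -1^-even (Nat.suc k) rewrite ℕₚ.+-suc k k = begin
    - 1# * (- 1# * (- 1#) ^ (k Nat.+ k))  ≈⟨ *-congˡ (*-congˡ (-1^-even k)) ⟩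
    - 1# * (- 1# * 1#)                    ≈⟨ *-congˡ (*-identityʳ _) ⟩
    - 1# * - 1#                           ≈⟨ -1*x≈-x _ ⟩
    - (- 1#)                              ≈⟨ -‿involutive 1# ⟩
    1#                                    ∎

  -1^-±1 : ∀ k → (- 1#) ^ k ≈ 1# ⊎ (- 1#) ^ k ≈ - 1#
  -1^-±1 Nat.zero = inj₁ refl
  -1^-±1 (Nat.suc k) with -1^-±1 k
  ... | inj₁ even = inj₂ (trans (*-congˡ even) (*-identityʳ _))
  ... | inj₂ odd  = inj₁ (trans (*-congˡ odd) (trans (-1*x≈-x _) (-‿involutive 1#)))

  sgn-cong : {π ρ : Permutation′ n} → π ≈ₚ ρ → sgn π ≈ sgn ρ
  sgn-cong {π = π} {ρ} π≈ρ = ^-congʳ (- 1#) (inversions-cong {π = π} {ρ} π≈ρ)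

  sgn-∙ : (τ σ : Permutation′ n) → sgn (τ ∙ σ) ≈ sgn τ * sgn σ
  sgn-∙ τ σ with inversions-∙ τ σ
  ... | k , eq = begin
    sgn (τ ∙ σ)                                        ≈⟨ *-identityʳ _ ⟨
    sgn (τ ∙ σ) * 1#                                   ≈⟨ *-congˡ (-1^-even k) ⟨
    sgn (τ ∙ σ) * (- 1#) ^ (k Nat.+ k)                 ≈⟨ ^-homo-* (- 1#) (inversions (τ ∙ σ)) _ ⟨
    (- 1#) ^ (inversions (τ ∙ σ) Nat.+ (k Nat.+ k))    ≈⟨ ^-congʳ (- 1#) eq ⟩
    (- 1#) ^ (inversions τ Nat.+ inversions σ)         ≈⟨ ^-homo-* (- 1#) (inversions τ) _ ⟩
    sgn τ * sgn σ                                      ∎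

  sgn-square : (π : Permutation′ n) → sgn π * sgn π ≈ 1#
  sgn-square π = trans (sym (^-homo-* (- 1#) (inversions π) _)) (-1^-even (inversions π))

  sgn-id : sgn (Perm.id {n = n}) ≈ 1#
  sgn-id {n} = trans (sgn-∙ (Perm.id {n = n}) Perm.id) (sgn-square (Perm.id {n = n}))

  sgn-flip : (π : Permutation′ n) → sgn (flip π) ≈ sgn π
  sgn-flip {n} π = begin
    sgn (flip π)                    ≈⟨ *-identityʳ _ ⟨
    sgn (flip π) * 1#               ≈⟨ *-congˡ (sgn-square π) ⟨
    sgn (flip π) * (sgn π * sgn π)  ≈⟨ *-assoc _ _ _ ⟨
    sgn (flip π) * sgn π * sgn π    ≈⟨ *-congʳ (sgn-∙ (flip π) π) ⟨
    sgn (flip π ∙ π) * sgn π        ≈⟨ *-congʳ (trans (sgn-cong {π = flip π ∙ π} {Perm.id} (λ _ → Perm.inverseˡ π)) (sgn-id {n})) ⟩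
    1# * sgn π                      ≈⟨ *-identityˡ _ ⟩
    sgn π                           ∎

-- Rearrangements of rows

tabulate-∘-↭ : ∀ {m} (f : Fin m → A) (g : Permutation′ m) → tabulate (f ∘ (g ⟨$⟩ʳ_)) ↭ tabulate f
tabulate-∘-↭ f g = ≡.subst₂ _↭_ (map-tabulate (g ⟨$⟩ʳ_) f) (map-tabulate id f)
  (map⁺ f (∼bag⇒↭ (unique∧set⇒bag
    (Uniqueₚ.tabulate⁺ (permutation-injective g)) (Uniqueₚ.allFin⁺ _)
    (mk⇔ (λ _ → ∈-allFin _) (λ _ → hit _)))))
  where
  hit : ∀ k → k ∈ tabulate (g ⟨$⟩ʳ_)
  hit k = subst (_∈ tabulate (g ⟨$⟩ʳ_)) (Perm.inverseʳ g) (∈-tabulate⁺ (g ⟨$⟩ˡ k))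

-- A rearrangement of a list is realised by a permutation of its positions.
↭⇒permutation : ∀ {m} (f g : Fin m → A) → tabulate f ↭ tabulate g →
                Σ[ π ∈ Permutation′ m ] (∀ i → f i ≡ g (π ⟨$⟩ʳ i))
↭⇒permutation f g f↭g = π , λ i → begin
  f i                                    ≡⟨ lookup-tabulate f i ⟨
  lookup (tabulate f) (Fin.cast _ i)     ≡⟨ onIndices-lookup (≡.setoid _) (↭⇒↭ₛ f↭g) _ ⟩
  lookup (tabulate g) (ι ⟨$⟩ʳ Fin.cast _ i)  ≡⟨ cong (lookup (tabulate g)) (Finₚ.cast-involutive _ (length-tabulate g) _) ⟨
  lookup (tabulate g) (Fin.cast _ (π ⟨$⟩ʳ i)) ≡⟨ lookup-tabulate g _ ⟩
  g (π ⟨$⟩ʳ i)                           ∎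
  where
  open ≡.≡-Reasoning
  ι = onIndices (↭⇒↭ₛ f↭g)
  π = Perm.cast-id (≡.sym (length-tabulate f)) Perm.∘ₚ ι Perm.∘ₚ Perm.cast-id (length-tabulate g)


box-injectiveʳ : {μ : Partition n} {i : Fin (length (Partition.parts μ))}
  {j k : Fin (lookup (Partition.parts μ) i)} → _≡_ {A = Box μ} (box i j) (box i k) → j ≡ k
box-injectiveʳ = Finₚ.toℕ-injective ∘ cong col

in-row : {μ : Partition n} (i : Fin (length (Partition.parts μ))) (b : Box μ) →
         row b ≡ toℕ i → ∃ λ j → b ≡ box i j
in-row i (box i′ j) eq with ≡.refl ← Finₚ.toℕ-injective eq = j , ≡.refl

module _ {μ : Partition n} where

  -- f maps each box to a box of the same row.
  PreservesBoxRows : (Box μ → Box μ) → Set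
  PreservesBoxRows f = ∀ b → row (f b) ≡ row b

  sameRows-∘ : (θ : Box μ ↔ Box μ) → PreservesBoxRows (Inverse.to θ) → (Z : Filling μ ℕ) →
               SameRows (Z ∘ Inverse.to θ) Z
  sameRows-∘ θ θ-rows Z i = ↭-trans
    (↭-reflexive (tabulate-cong (λ j → cong Z (proj₂ (moved to θ-rows j)))))
    (tabulate-∘-↭ (λ j → Z (box i j)) (Perm.permutation
      (proj₁ ∘ moved to θ-rows) (proj₁ ∘ moved from θ⁻¹-rows)
      (cancel to from θ-rows θ⁻¹-rows strictlyInverseˡ)
      (cancel from to θ⁻¹-rows θ-rows strictlyInverseʳ)))
    where
    open Inverse θ

    θ⁻¹-rows : PreservesBoxRows from
    θ⁻¹-rows b = ≡.trans (≡.sym (θ-rows (from b))) (cong row (strictlyInverseˡ b))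

    moved : ∀ f → PreservesBoxRows f → ∀ j → ∃ λ k → f (box i j) ≡ box i k
    moved f f-rows j = in-row i (f (box i j)) (f-rows (box i j))

    cancel : ∀ f g (f-rows : PreservesBoxRows f) (g-rows : PreservesBoxRows g) →
      (∀ b → f (g b) ≡ b) → ∀ j → proj₁ (moved f f-rows (proj₁ (moved g g-rows j))) ≡ j
    cancel f g f-rows g-rows fg j = box-injectiveʳ {μ = μ} (≡.trans
      (≡.sym (≡.trans (cong f (proj₂ (moved g g-rows j))) (proj₂ (moved f f-rows _))))
      (fg (box i j)))

  -- Conversely, fillings with equal rows as multisets differ by a bijection of
  -- the boxes, assembled from one permutation for each row.
  sameRows⇒∘ : {Y Z : Filling μ ℕ} → SameRows Y Z →
    Σ[ θ ∈ Box μ ↔ Box μ ] PreservesBoxRows (Inverse.to θ) × Y ≗ Z ∘ Inverse.to θ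
  sameRows⇒∘ {Y} {Z} Y~Z =
    mk↔ₛ′ (λ (box i j) → box i (g i ⟨$⟩ʳ j)) (λ (box i j) → box i (g i ⟨$⟩ˡ j))
      (λ (box i j) → cong (box i) (Perm.inverseʳ (g i)))
      (λ (box i j) → cong (box i) (Perm.inverseˡ (g i))) ,
    (λ _ → ≡.refl) ,
    (λ (box i j) → proj₂ (row-permutation i) j)
    where
    row-permutation = λ i → ↭⇒permutation (λ j → Y (box i j)) (λ j → Z (box i j)) (Y~Z i)

    g : ∀ i → Permutation′ (lookup (Partition.parts μ) i)
    g i = proj₁ (row-permutation i)

-- Row and column permutations

module _ {μ : Partition n} (Q : BijectiveFilling μ) where

  preservesRows-∙ : ∀ {τ σ} → PreservesRows Q τ → PreservesRows Q σ → PreservesRows Q (τ ∙ σ)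
  preservesRows-∙ {σ = σ} τ-rows σ-rows v = ≡.trans (τ-rows (σ ⟨$⟩ʳ v)) (σ-rows v)

  preservesRows-cancelˡ : ∀ {τ σ} → PreservesRows Q τ → PreservesRows Q (τ ∙ σ) → PreservesRows Q σ
  preservesRows-cancelˡ {σ = σ} τ-rows τσ-rows v = ≡.trans (≡.sym (τ-rows (σ ⟨$⟩ʳ v))) (τσ-rows v)

  preservesRows-flip : ∀ {σ} → PreservesRows Q σ → PreservesRows Q (flip σ)
  preservesRows-flip {σ} σ-rows v =
    ≡.trans (≡.sym (σ-rows (σ ⟨$⟩ˡ v))) (cong (λ w → row (position Q w)) (Perm.inverseʳ σ))

  preservesRows-cong : ∀ {σ ρ} → σ ≈ₚ ρ → PreservesRows Q σ → PreservesRows Q ρ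
  preservesRows-cong σ≈ρ σ-rows v =
    ≡.trans (cong (λ w → row (position Q w)) (≡.sym (σ≈ρ v))) (σ-rows v)

  preservesColumns-cong : ∀ {σ ρ} → σ ≈ₚ ρ → PreservesColumns Q σ → PreservesColumns Q ρ
  preservesColumns-cong σ≈ρ σ-cols v =
    ≡.trans (cong (λ w → col (position Q w)) (≡.sym (σ≈ρ v))) (σ-cols v)

sameRows-trans : {μ : Partition n} {X Y Z : Filling μ ℕ} → SameRows X Y → SameRows Y Z → SameRows X Z
sameRows-trans X~Y Y~Z i = ↭-trans (X~Y i) (Y~Z i)

sameRows-sym : {μ : Partition n} {Y Z : Filling μ ℕ} → SameRows Y Z → SameRows Z Y
sameRows-sym Y~Z i = ↭-sym (Y~Z i)

sameRows-reflexive : {μ : Partition n} {Y Z : Filling μ ℕ} → Y ≗ Z → SameRows Y Z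
sameRows-reflexive Y≗Z i = ↭-reflexive (tabulate-cong (λ j → Y≗Z (box i j)))

-- Permutations acting on fillings through a labelling of the boxes

module Action {μ : Partition n} (K : BijectiveFilling μ) where
  private module K = Inverse K

  -- (π ▹ Z)(b) is Z at the box that π carries to b, when boxes are identified
  -- with their labels under K.  For the canonical labelling it is the action _•_;
  -- the arguments below hold for every labelling.
  infixr 8 _▹_
  _▹_ : Permutation′ n → Filling μ A → Filling μ A
  (π ▹ Z) b = Z (K.from (π ⟨$⟩ˡ K.to b))

  ▹-∙ : (τ σ : Permutation′ n) (Z : Filling μ A) → (τ ∙ σ) ▹ Z ≗ τ ▹ (σ ▹ Z)
  ▹-∙ τ σ Z b = cong (λ v → Z (K.from (σ ⟨$⟩ˡ v))) (≡.sym (K.strictlyInverseˡ _))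

  ▹-congˡ : {σ ρ : Permutation′ n} → σ ≈ₚ ρ → (Z : Filling μ A) → σ ▹ Z ≗ ρ ▹ Z
  ▹-congˡ {σ = σ} {ρ} σ≈ρ Z b = cong (λ v → Z (K.from v)) (flip-cong {π = σ} {ρ} σ≈ρ (K.to b))

  ▹-cong : (σ : Permutation′ n) {Y Z : Filling μ A} → Y ≗ Z → σ ▹ Y ≗ σ ▹ Z
  ▹-cong σ Y≗Z b = Y≗Z (K.from (σ ⟨$⟩ˡ K.to b))

  ▹-inverse : (σ : Permutation′ n) {Y Z : Filling μ A} → σ ▹ Y ≗ σ ▹ Z → Y ≗ Z
  ▹-inverse σ {Y} {Z} eq b = begin
    Y b                  ≡⟨ cong Y back ⟨
    Y (K.from (σ ⟨$⟩ˡ K.to c)) ≡⟨ eq c ⟩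
    Z (K.from (σ ⟨$⟩ˡ K.to c)) ≡⟨ cong Z back ⟩
    Z b                  ∎
    where
    open ≡.≡-Reasoning
    c = K.from (σ ⟨$⟩ʳ K.to b)
    back : K.from (σ ⟨$⟩ˡ K.to c) ≡ b
    back = ≡.trans (cong (λ v → K.from (σ ⟨$⟩ˡ v)) (K.strictlyInverseˡ _))
             (≡.trans (cong K.from (Perm.inverseˡ σ)) (K.strictlyInverseʳ b))

  rowPermutation⇒sameRows : ∀ {σ} → PreservesRows K σ → (Z : Filling μ ℕ) → SameRows (σ ▹ Z) Z
  rowPermutation⇒sameRows {σ} σ-rows = sameRows-∘
    (↔-sym K ↔-∘ (flip σ ↔-∘ K))
    (λ b → ≡.trans (preservesRows-flip K {σ} σ-rows (K.to b)) (cong row (K.strictlyInverseʳ b)))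

  sameRows⇒rowPermutation : {Y Z : Filling μ ℕ} → SameRows Y Z →
    Σ[ σ ∈ Permutation′ n ] PreservesRows K σ × σ ▹ Z ≗ Y
  sameRows⇒rowPermutation {Y} {Z} Y~Z = σ ,
    preservesRows-flip K {flip σ} (λ v →
      ≡.trans (cong row (K.strictlyInverseʳ (θ.to (K.from v)))) (θ-rows (K.from v))) ,
    λ b → ≡.trans (cong Z (≡.trans (K.strictlyInverseʳ _) (cong θ.to (K.strictlyInverseʳ b)))) (≡.sym (Y≗Z∘θ b))
    where
    module θ = Inverse (proj₁ (sameRows⇒∘ {μ = μ} {Y} {Z} Y~Z))
    θ-rows = proj₁ (proj₂ (sameRows⇒∘ {μ = μ} {Y} {Z} Y~Z))
    Y≗Z∘θ  = proj₂ (proj₂ (sameRows⇒∘ {μ = μ} {Y} {Z} Y~Z))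

    σ : Permutation′ n
    σ = flip (K ↔-∘ (proj₁ (sameRows⇒∘ {μ = μ} {Y} {Z} Y~Z) ↔-∘ ↔-sym K))

  ▹-sameRows : ∀ {σ ρ} → σ ≈ₚ ρ → (Z : Filling μ ℕ) → SameRows (σ ▹ Z) Z → SameRows (ρ ▹ Z) Z
  ▹-sameRows {σ} {ρ} σ≈ρ Z = sameRows-trans {X = ρ ▹ Z} {σ ▹ Z} {Z}
    (sameRows-reflexive {Y = ρ ▹ Z} {σ ▹ Z} (λ b → ≡.sym (▹-congˡ {σ = σ} {ρ} σ≈ρ Z b)))

≈ₚ-decSetoid : ℕ → DecSetoid 0ℓ 0ℓ
≈ₚ-decSetoid n = record
  { isDecEquivalence = record
    { isEquivalence = Setoid.isEquivalence (≈ₚ-setoid n)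
    ; _≟_           = λ π ρ → Finₚ.all? λ i → (π ⟨$⟩ʳ i) Finₚ.≟ (ρ ⟨$⟩ʳ i)
    }
  }

-- Transport of T to the labelling of the boxes

module Transport {μ : Partition n} (K T P : BijectiveFilling μ) (π : Permutation′ n) where
  private
    module K = Inverse K
    module T = Inverse T
    module P = Inverse P

  -- α sends an entry of T to the label of its box.  β sends the label of a box to
  -- the entry that it contains once π has been applied to P.
  α β : Permutation′ n
  α = K ↔-∘ ↔-sym T
  β = (P ↔-∘ ↔-sym K) ∙ flip π

  -- R(T) corresponds to the row permutations of boxes.
  conjugate : Permutation′ n → Permutation′ n
  conjugate σ = α ∙ σ ∙ flip α

  unconjugate : Permutation′ n → Permutation′ n
  unconjugate σ = flip α ∙ σ ∙ α

  conjugate-adjoint : ∀ {σ ρ} → conjugate σ ≈ₚ ρ ⇔ unconjugate ρ ≈ₚ σ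
  conjugate-adjoint {σ} {ρ} = mk⇔
    (λ eq v → ≡.trans (cong (α ⟨$⟩ˡ_) (≡.sym (eq (α ⟨$⟩ʳ v))))
                (≡.trans (Perm.inverseˡ α) (cong (σ ⟨$⟩ʳ_) (Perm.inverseˡ α))))
    (λ eq v → ≡.trans (cong (α ⟨$⟩ʳ_) (≡.sym (eq (α ⟨$⟩ˡ v))))
                (≡.trans (Perm.inverseʳ α) (cong (ρ ⟨$⟩ʳ_) (Perm.inverseʳ α))))

  -- C(T) corresponds to the column permutations of boxes, provided that π returns
  -- the entries of P to their columns in T.
  twist untwist : Permutation′ n → Permutation′ n
  twist   τ = α ∙ flip τ ∙ β
  untwist ω = β ∙ flip ω ∙ α

  twist-adjoint : ∀ {τ ω} → twist τ ≈ₚ ω ⇔ untwist ω ≈ₚ τ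
  twist-adjoint {τ} {ω} = mk⇔ (transpose α β τ ω) (transpose β α ω τ)
    where
    -- Solving for τ exchanges the roles of α and β.
    transpose : ∀ (α β τ ω : Permutation′ n) → α ∙ flip τ ∙ β ≈ₚ ω → β ∙ flip ω ∙ α ≈ₚ τ
    transpose α β τ ω eq v = begin
      β ⟨$⟩ʳ (ω ⟨$⟩ˡ (α ⟨$⟩ʳ v))                       ≡⟨ cong (λ w → β ⟨$⟩ʳ (ω ⟨$⟩ˡ (α ⟨$⟩ʳ w))) (Perm.inverseˡ τ) ⟨
      β ⟨$⟩ʳ (ω ⟨$⟩ˡ (α ⟨$⟩ʳ (τ ⟨$⟩ˡ (τ ⟨$⟩ʳ v))))         ≡⟨ cong (λ w → β ⟨$⟩ʳ (ω ⟨$⟩ˡ (α ⟨$⟩ʳ (τ ⟨$⟩ˡ w)))) (Perm.inverseʳ β) ⟨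
      β ⟨$⟩ʳ (ω ⟨$⟩ˡ (α ∙ flip τ ∙ β ⟨$⟩ʳ (β ⟨$⟩ˡ (τ ⟨$⟩ʳ v)))) ≡⟨ cong (λ w → β ⟨$⟩ʳ (ω ⟨$⟩ˡ w)) (eq _) ⟩
      β ⟨$⟩ʳ (ω ⟨$⟩ˡ (ω ⟨$⟩ʳ (β ⟨$⟩ˡ (τ ⟨$⟩ʳ v))))         ≡⟨ cong (β ⟨$⟩ʳ_) (Perm.inverseˡ ω) ⟩
      β ⟨$⟩ʳ (β ⟨$⟩ˡ (τ ⟨$⟩ʳ v))                         ≡⟨ Perm.inverseʳ β ⟩
      τ ⟨$⟩ʳ v                                         ∎
      where open ≡.≡-Reasoning

  conjugate-rows : ∀ {σ} → PreservesRows T σ ⇔ PreservesRows K (conjugate σ)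
  conjugate-rows {σ} = mk⇔
    (λ σ-rows v → ≡.trans (cong row (K.strictlyInverseʳ _))
      (≡.trans (σ-rows _) (cong row (T.strictlyInverseʳ (K.from v)))))
    (λ σ-rows w → begin
      row (T.from (σ ⟨$⟩ʳ w))
        ≡⟨ cong (λ v → row (T.from (σ ⟨$⟩ʳ v))) (≡.trans (cong T.to (K.strictlyInverseʳ _)) (T.strictlyInverseˡ w)) ⟨
      row (T.from (σ ⟨$⟩ʳ T.to (K.from (K.to (T.from w)))))
        ≡⟨ cong row (K.strictlyInverseʳ _) ⟨
      row (K.from (conjugate σ ⟨$⟩ʳ K.to (T.from w)))
        ≡⟨ σ-rows _ ⟩
      row (K.from (K.to (T.from w)))
        ≡⟨ cong row (K.strictlyInverseʳ _) ⟩
      row (T.from w) ∎)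
    where open ≡.≡-Reasoning

  -- The hypothesis says that column j of π ▹ P has the entries of column j of T.
  twist-columns : (∀ v → col (K.from v) ≡ col (T.from (β ⟨$⟩ʳ v))) →
                  ∀ {τ} → PreservesColumns T τ ⇔ PreservesColumns K (twist τ)
  twist-columns β-col {τ} = mk⇔
    (λ τ-cols v → begin
      col (K.from (K.to (T.from (τ ⟨$⟩ˡ (β ⟨$⟩ʳ v)))))  ≡⟨ cong (λ c → col c) (K.strictlyInverseʳ _) ⟩
      col (T.from (τ ⟨$⟩ˡ (β ⟨$⟩ʳ v)))                  ≡⟨ τ-cols _ ⟨
      col (T.from (τ ⟨$⟩ʳ (τ ⟨$⟩ˡ (β ⟨$⟩ʳ v))))           ≡⟨ cong (λ w → col (T.from w)) (Perm.inverseʳ τ) ⟩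
      col (T.from (β ⟨$⟩ʳ v))                           ≡⟨ β-col v ⟨
      col (K.from v)                                    ∎)
    (λ ω-cols w → let v = β ⟨$⟩ˡ (τ ⟨$⟩ʳ w) in begin
      col (T.from (τ ⟨$⟩ʳ w))                           ≡⟨ cong (λ u → col (T.from u)) (Perm.inverseʳ β) ⟨
      col (T.from (β ⟨$⟩ʳ v))                           ≡⟨ β-col v ⟨
      col (K.from v)                                    ≡⟨ ω-cols v ⟨
      col (K.from (K.to (T.from (τ ⟨$⟩ˡ (β ⟨$⟩ʳ v)))))  ≡⟨ cong (λ c → col c) (K.strictlyInverseʳ _) ⟩
      col (T.from (τ ⟨$⟩ˡ (β ⟨$⟩ʳ v)))                  ≡⟨ cong (λ u → col (T.from (τ ⟨$⟩ˡ u))) (Perm.inverseʳ β) ⟩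
      col (T.from (τ ⟨$⟩ˡ (τ ⟨$⟩ʳ w)))                  ≡⟨ cong (λ u → col (T.from u)) (Perm.inverseˡ τ) ⟩
      col (T.from w)                                    ∎)
    where open ≡.≡-Reasoning

  module _ (S : Filling μ ℕ) where
    conjugate-filling : ∀ σ c → S (K.from (conjugate σ ⟨$⟩ˡ K.to c)) ≡ S (T.from (σ ⟨$⟩ˡ T.to c))
    conjugate-filling σ c = cong S (≡.trans (K.strictlyInverseʳ _)
      (cong (λ d → T.from (σ ⟨$⟩ˡ T.to d)) (K.strictlyInverseʳ c)))

    twist-filling : ∀ τ c → S (K.from (π ⟨$⟩ˡ K.to (K.from (twist τ ⟨$⟩ˡ K.to c)))) ≡ S (P.from (τ ⟨$⟩ʳ T.to c))
    twist-filling τ c = cong S (≡.trans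
      (cong K.from (≡.trans (cong (π ⟨$⟩ˡ_) (K.strictlyInverseˡ _)) (Perm.inverseˡ π)))
      (≡.trans (K.strictlyInverseʳ _) (cong (λ d → P.from (τ ⟨$⟩ʳ T.to d)) (K.strictlyInverseʳ c))))

    -- τ σ maps x_T^S to x_P^S exactly when
    -- conjugate σ ▹ S = twist τ ▹ (π ▹ S), spelled out box by box.
    monomial-equation : ∀ τ σ → actₘ (τ ∙ σ) (x^ T S) ≗ x^ P S ⇔
      (λ c → S (K.from (conjugate σ ⟨$⟩ˡ K.to c))) ≗
      (λ c → S (K.from (π ⟨$⟩ˡ K.to (K.from (twist τ ⟨$⟩ˡ K.to c)))))
    monomial-equation τ σ = mk⇔
      (λ eq c → ≡.trans (conjugate-filling σ c) (≡.trans
        (cong (λ v → S (T.from (σ ⟨$⟩ˡ v))) (≡.sym (Perm.inverseˡ τ)))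
        (≡.trans (eq (τ ⟨$⟩ʳ T.to c)) (≡.sym (twist-filling τ c)))))
      (λ eq v → let c = T.from (τ ⟨$⟩ˡ v) in begin
        S (T.from (σ ⟨$⟩ˡ (τ ⟨$⟩ˡ v)))  ≡⟨ cong (λ w → S (T.from (σ ⟨$⟩ˡ w))) (T.strictlyInverseˡ _) ⟨
        S (T.from (σ ⟨$⟩ˡ T.to c))      ≡⟨ conjugate-filling σ c ⟨
        _                               ≡⟨ eq c ⟩
        _                               ≡⟨ twist-filling τ c ⟩
        S (P.from (τ ⟨$⟩ʳ T.to c))      ≡⟨ cong (λ w → S (P.from (τ ⟨$⟩ʳ w))) (T.strictlyInverseˡ _) ⟩
        S (P.from (τ ⟨$⟩ʳ (τ ⟨$⟩ˡ v)))  ≡⟨ cong (λ w → S (P.from w)) (Perm.inverseʳ τ) ⟩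
        S (P.from v)                    ∎)
      where open ≡.≡-Reasoning

-- The coefficient

module Coefficients {c ℓ} (R : CommutativeRing c ℓ) {n : ℕ} where
  open CommutativeRing R
  open Polynomials R hiding (∑)
  open Sums +-commutativeMonoid
  open Signs R
  open import Algebra.Properties.CommutativeMonoid.Mult +-commutativeMonoid using (×-congʳ; ×-distrib-+)
  open import Algebra.Properties.CommutativeSemigroup *-commutativeSemigroup using (interchange; x∙yz≈xz∙y)
  open import Algebra.Properties.Ring ring using (-1*x≈-x)
  open import Algebra.Properties.Semiring.Exp semiring using (^-homo-*)
  open import Algebra.Properties.Semiring.Mult semiring using (×-comm-*)
  open import Relation.Binary.Reasoning.Setoid setoid

  ∑-permutations : (φ ψ : Permutation′ n → Permutation′ n) → (∀ {π ρ} → φ π ≈ₚ ρ ⇔ ψ ρ ≈ₚ π) →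
    (f : Permutation′ n → Carrier) → (∀ {π ρ} → π ≈ₚ ρ → f π ≈ f ρ) →
    ∑ (permutations n) (f ∘ φ) ≈ ∑ (permutations n) f
  ∑-permutations = ∑-reindex (≈ₚ-decSetoid n) (permutations-unique n) permutations-complete

  ∑-const : (xs : List A) (x : Carrier) → ∑ xs (λ _ → x) ≈ length xs · x
  ∑-const []       x = refl
  ∑-const (_ ∷ xs) x = +-congˡ (∑-const xs x)

  -- Only the existence of a decision procedure for SameRows matters, so it is a
  -- parameter.
  module _ {μ : Partition n} (K : BijectiveFilling μ)
    (same? : (Y Z : Filling μ ℕ) → Dec (SameRows Y Z)) where
    open Action K

    -- The row permutations that fix S; this is H(S) for the canonical labelling.
    Stabiliser : Filling μ ℕ → List (Permutation′ n)
    Stabiliser S = filter (λ ρ → ≗-dec (ρ ▹ S) S) (rowGroup K)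

    -- The column permutations that keep the multiset of entries of each row of Z;
    -- this is A(Z) for the canonical labelling.
    RowPreserving : Filling μ ℕ → List (Permutation′ n)
    RowPreserving Z = filter (λ τ → same? (τ ▹ Z) Z) (columnGroup K)

    filter-RowPreserving : {Q : Permutation′ n → Set} (Q? : Decidable Q) (Z : Filling μ ℕ) →
                       (∀ τ → Q τ ⇔ SameRows (τ ▹ Z) Z) → filter Q? (columnGroup K) ≡ RowPreserving Z
    filter-RowPreserving Q? Z Q⇔ = filter-≐ Q? (λ τ → same? (τ ▹ Z) Z)
      ((λ {τ} → Equivalence.to (Q⇔ τ)) , (λ {τ} → Equivalence.from (Q⇔ τ))) (columnGroup K)

    -- x if σ is a row permutation with σ ▹ S = Y, and 0 otherwise.
    solution : (S Y : Filling μ ℕ) → Carrier → Permutation′ n → Carrier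
    solution S Y x σ = when (preservesRows? K σ) (when (≗-dec (σ ▹ S) Y) x)

    solution-cong : ∀ S Y x {σ ρ} → σ ≈ₚ ρ → solution S Y x σ ≈ solution S Y x ρ
    solution-cong S Y x {σ} {ρ} σ≈ρ = when-cong (preservesRows? K σ) (preservesRows? K ρ)
      (mk⇔ (preservesRows-cong K {σ} {ρ} σ≈ρ)
           (preservesRows-cong K {ρ} {σ} (λ v → ≡.sym (σ≈ρ v))))
      (when-cong (≗-dec (σ ▹ S) Y) (≗-dec (ρ ▹ S) Y)
        (mk⇔ (λ eq b → ≡.trans (≡.sym (▹-congˡ {σ = σ} {ρ} σ≈ρ S b)) (eq b))
             (λ eq b → ≡.trans (▹-congˡ {σ = σ} {ρ} σ≈ρ S b) (eq b)))
        refl)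

    -- The row permutations that carry S to Y form a coset ρ H(S), or there are
    -- none.
    ∑-solutions : ∀ S Y x → ∑ (permutations n) (solution S Y x) ≈ when (same? Y S) (length (Stabiliser S) · x)
    ∑-solutions S Y x = by-cases (same? Y S)
      where
      translate : (Σ[ ρ ∈ Permutation′ n ] PreservesRows K ρ × ρ ▹ S ≗ Y) →
                  ∑ (permutations n) (solution S Y x) ≈ length (Stabiliser S) · x
      translate (ρ , ρ-rows , ρS≗Y) = begin
        ∑ (permutations n) (solution S Y x)
          ≈⟨ ∑-permutations (ρ ∙_) (flip ρ ∙_)
               (λ {π} {ω} → mk⇔
                 (λ eq v → ≡.trans (cong (ρ ⟨$⟩ˡ_) (≡.sym (eq v))) (Perm.inverseˡ ρ))
                 (λ eq v → ≡.trans (cong (ρ ⟨$⟩ʳ_) (≡.sym (eq v))) (Perm.inverseʳ ρ)))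
               (solution S Y x) (λ {π} {ω} → solution-cong S Y x {π} {ω}) ⟨
        ∑ (permutations n) (λ θ → solution S Y x (ρ ∙ θ))
          ≈⟨ ∑-cong (permutations n) (λ θ → when-cong (preservesRows? K (ρ ∙ θ)) (preservesRows? K θ)
               (mk⇔ (preservesRows-cancelˡ K {ρ} {θ} ρ-rows)
                    (preservesRows-∙ K {ρ} {θ} ρ-rows))
               (when-cong (≗-dec ((ρ ∙ θ) ▹ S) Y) (≗-dec (θ ▹ S) S)
                 (mk⇔ (λ eq → ▹-inverse ρ {θ ▹ S} {S} (λ b →
                         ≡.trans (≡.sym (▹-∙ ρ θ S b)) (≡.trans (eq b) (≡.sym (ρS≗Y b)))))
                      (λ eq b → ≡.trans (▹-∙ ρ θ S b) (≡.trans (▹-cong ρ eq b) (ρS≗Y b))))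
                 refl)) ⟩
        ∑ (permutations n) (solution S S x)
          ≈⟨ ∑-filter (preservesRows? K) (permutations n) _ ⟨
        ∑ (rowGroup K) (λ θ → when (≗-dec (θ ▹ S) S) x)
          ≈⟨ ∑-filter (λ θ → ≗-dec (θ ▹ S) S) (rowGroup K) _ ⟨
        ∑ (Stabiliser S) (λ _ → x)
          ≈⟨ ∑-const (Stabiliser S) x ⟩
        length (Stabiliser S) · x ∎

      solvable : SameRows Y S → ∑ (permutations n) (solution S Y x) ≈ length (Stabiliser S) · x
      solvable same = translate (sameRows⇒rowPermutation {Y} {S} same)

      unsolvable : ¬ SameRows Y S → ∀ σ → solution S Y x σ ≈ 0#
      unsolvable differ σ = vanish (preservesRows? K σ)
        where
        vanish : Dec (PreservesRows K σ) → solution S Y x σ ≈ 0#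
        vanish (no ¬rows) = when-false (preservesRows? K σ) ¬rows
        vanish (yes rows) = trans (when-true (preservesRows? K σ) rows)
          (when-false (≗-dec (σ ▹ S) Y) (λ eq → differ
            (sameRows-trans {μ = μ} {Y} {σ ▹ S} {S}
              (sameRows-reflexive {μ = μ} (λ b → ≡.sym (eq b)))
              (rowPermutation⇒sameRows {σ = σ} rows S))))

      by-cases : Dec (SameRows Y S) → ∑ (permutations n) (solution S Y x) ≈ when (same? Y S) (length (Stabiliser S) · x)
      by-cases (yes same) = trans (solvable same) (sym (when-true (same? Y S) same))
      by-cases (no ¬same) = trans (∑-0# (All.universal (unsolvable ¬same) (permutations n)))
        (sym (when-false (same? Y S) ¬same))

    -- The coefficient of any monomial m, with all conditions written as
    -- indicators inside a double sum over the symmetric group.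
    coefficient-F : (T : BijectiveFilling μ) (S : Filling μ ℕ) (m : Monomial n) →
      coefficient m (F T S) ≈
      ∑ (permutations n) λ τ → when (preservesColumns? T τ)
        (∑ (permutations n) λ σ → when (preservesRows? T σ)
          (when (actₘ (τ ∙ σ) (x^ T S) ≗? m) (sgn τ)))
    coefficient-F T S m = begin
      coefficient m (F T S)
        ≈⟨ ∑-filter (λ t → proj₂ t ≗? m) (F T S) proj₁ ⟩
      ∑ (F T S) (λ t → when (proj₂ t ≗? m) (proj₁ t))
        ≈⟨ ∑-cartesianProductWith _ (ε T) _ _ ⟩
      ∑ (ε T) (λ t → when (actₘ (proj₂ t) (x^ T S) ≗? m) (proj₁ t * 1#) + 0#)
        ≈⟨ ∑-cartesianProductWith _ (columnGroup T) (rowGroup T) _ ⟩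
      ∑ (columnGroup T) (λ τ → ∑ (rowGroup T) λ σ →
        when (actₘ (τ ∙ σ) (x^ T S) ≗? m) (sgn τ * 1#) + 0#)
        ≈⟨ ∑-filter (preservesColumns? T) (permutations n) _ ⟩
      ∑ (permutations n) (λ τ → when (preservesColumns? T τ) (∑ (rowGroup T) λ σ →
        when (actₘ (τ ∙ σ) (x^ T S) ≗? m) (sgn τ * 1#) + 0#))
        ≈⟨ ∑-cong (permutations n) (λ τ → when-cong (preservesColumns? T τ) (preservesColumns? T τ) (⇔-id _) (trans
             (∑-filter (preservesRows? T) (permutations n) _)
             (∑-cong (permutations n) (λ σ → when-cong (preservesRows? T σ) (preservesRows? T σ) (⇔-id _)
               (trans (+-identityʳ _) (when-cong (actₘ (τ ∙ σ) (x^ T S) ≗? m) (actₘ (τ ∙ σ) (x^ T S) ≗? m)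
                 (⇔-id _) (*-identityʳ _))))))) ⟩
      _ ∎

    module _ (T P : BijectiveFilling μ) (π : Permutation′ n) (π-rows : PreservesRows K π)
      (π-columns : ∀ j v → OccursInColumn (π ▹ Inverse.to P) j v ⇔ OccursInColumn (Inverse.to T) j v)
      (S : Filling μ ℕ) where
      private
        module K = Inverse K
        module T = Inverse T
        module P = Inverse P
        Z : Filling μ ℕ
        Z = π ▹ S

      open Transport K T P π

      -- The global sign of the formula.
      orientation : Carrier
      orientation = sgn α * sgn β

      -- The returning property of π, in terms of labels.
      β-column : ∀ v → col (K.from v) ≡ col (T.from (β ⟨$⟩ʳ v))
      β-column v = from-T (Equivalence.to (π-columns (col (K.from v)) (β ⟨$⟩ʳ v))
        (K.from v , ≡.refl , cong (λ w → P.to (K.from (π ⟨$⟩ˡ w))) (K.strictlyInverseˡ v)))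
        where
        from-T : OccursInColumn T.to (col (K.from v)) (β ⟨$⟩ʳ v) → col (K.from v) ≡ col (T.from (β ⟨$⟩ʳ v))
        from-T (d , d-col , d-entry) = ≡.trans (≡.sym d-col)
          (cong (λ c → col c) (≡.trans (≡.sym (T.strictlyInverseʳ d)) (cong T.from d-entry)))

      sgn-twist : ∀ τ → sgn τ ≈ orientation * sgn (twist τ)
      sgn-twist τ = sym (begin
        orientation * sgn (α ∙ flip τ ∙ β)               ≈⟨ *-congˡ (trans (sgn-∙ α (flip τ ∙ β))
                                                     (*-congˡ (trans (sgn-∙ (flip τ) β) (*-congʳ (sgn-flip τ))))) ⟩
        orientation * (sgn α * (sgn τ * sgn β))          ≈⟨ *-congˡ (x∙yz≈xz∙y _ _ _) ⟩
        orientation * (orientation * sgn τ)                        ≈⟨ *-assoc _ _ _ ⟨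
        orientation * orientation * sgn τ                          ≈⟨ *-congʳ (interchange _ _ _ _) ⟩
        (sgn α * sgn α) * (sgn β * sgn β) * sgn τ ≈⟨ *-congʳ (trans (*-cong (sgn-square α) (sgn-square β)) (*-identityˡ 1#)) ⟩
        1# * sgn τ                             ≈⟨ *-identityˡ _ ⟩
        sgn τ                                  ∎)

      -- The contribution of the column permutation ω of boxes.
      summand : Permutation′ n → Carrier
      summand ω = when (preservesColumns? K ω) (when (same? (ω ▹ Z) Z) (orientation * (length (Stabiliser S) · sgn ω)))

      summand-cong : ∀ {ω ρ} → ω ≈ₚ ρ → summand ω ≈ summand ρ
      summand-cong {ω} {ρ} ω≈ρ = when-cong (preservesColumns? K ω) (preservesColumns? K ρ)
        (mk⇔ (preservesColumns-cong K {ω} {ρ} ω≈ρ)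
             (preservesColumns-cong K {ρ} {ω} (λ v → ≡.sym (ω≈ρ v))))
        (when-cong (same? (ω ▹ Z) Z) (same? (ρ ▹ Z) Z)
          (mk⇔ (▹-sameRows {ω} {ρ} ω≈ρ Z)
               (▹-sameRows {ρ} {ω} (λ v → ≡.sym (ω≈ρ v)) Z))
          (*-congˡ (×-congʳ (length (Stabiliser S)) (sgn-cong {π = ω} {ρ} ω≈ρ))))

      -- The sum over R(T) for a fixed column permutation τ.
      ∑-over-rows : ∀ τ → ∑ (permutations n) (λ σ → when (preservesRows? T σ)
                      (when (actₘ (τ ∙ σ) (x^ T S) ≗? x^ P S) (sgn τ))) ≈
                    when (same? (twist τ ▹ Z) Z) (orientation * (length (Stabiliser S) · sgn (twist τ)))
      ∑-over-rows τ = begin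
        _ ≈⟨ ∑-cong (permutations n) (λ σ →
               when-cong (preservesRows? T σ) (preservesRows? K (conjugate σ)) (conjugate-rows {σ})
                 (when-cong (actₘ (τ ∙ σ) (x^ T S) ≗? x^ P S) (≗-dec (conjugate σ ▹ S) Y)
                   (monomial-equation S τ σ) refl)) ⟩
        ∑ (permutations n) (λ σ → solution S Y (sgn τ) (conjugate σ))
          ≈⟨ ∑-permutations conjugate unconjugate (λ {σ} {ρ} → conjugate-adjoint {σ} {ρ})
               (solution S Y (sgn τ)) (λ {σ} {ρ} → solution-cong S Y (sgn τ) {σ} {ρ}) ⟩
        ∑ (permutations n) (solution S Y (sgn τ))
          ≈⟨ ∑-solutions S Y (sgn τ) ⟩
        when (same? Y S) (length (Stabiliser S) · sgn τ)
          ≈⟨ when-cong (same? Y S) (same? Y Z)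
               (mk⇔ (λ same → sameRows-trans {μ = μ} {Y} {S} {Z} same (sameRows-sym {μ = μ} {Z} {S} Z~S))
                    (λ same → sameRows-trans {μ = μ} {Y} {Z} {S} same Z~S))
               (trans (×-congʳ (length (Stabiliser S)) (sgn-twist τ)) (sym (×-comm-* (length (Stabiliser S)) orientation _))) ⟩
        _ ∎
        where
        Y = twist τ ▹ Z
        Z~S : SameRows Z S
        Z~S = rowPermutation⇒sameRows {σ = π} π-rows S

      coefficient-snaking : coefficient (x^ P S) (F T S) ≈ orientation * (length (Stabiliser S) · ∑ (RowPreserving Z) sgn)
      coefficient-snaking = begin
        coefficient (x^ P S) (F T S)
          ≈⟨ coefficient-F T S (x^ P S) ⟩
        _ ≈⟨ ∑-cong (permutations n) (λ τ → when-cong (preservesColumns? T τ) (preservesColumns? K (twist τ))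
               (twist-columns β-column {τ}) (∑-over-rows τ)) ⟩
        ∑ (permutations n) (λ τ → summand (twist τ))
          ≈⟨ ∑-permutations twist untwist (λ {τ} {ω} → twist-adjoint {τ} {ω})
               summand (λ {ω} {ρ} → summand-cong {ω} {ρ}) ⟩
        ∑ (permutations n) summand
          ≈⟨ ∑-filter (preservesColumns? K) (permutations n) _ ⟨
        ∑ (columnGroup K) (λ ω → when (same? (ω ▹ Z) Z) (orientation * (length (Stabiliser S) · sgn ω)))
          ≈⟨ ∑-filter (λ ω → same? (ω ▹ Z) Z) (columnGroup K) _ ⟨
        ∑ (RowPreserving Z) (λ ω → orientation * (length (Stabiliser S) · sgn ω))
          ≈⟨ ∑-homo (λ x → orientation * (length (Stabiliser S) · x))
               (trans (*-congˡ (trans (sym (∑-const (Stabiliser S) 0#))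
                 (∑-0# (All.universal (λ _ → refl) (Stabiliser S))))) (zeroʳ orientation))
               (λ x y → trans (*-congˡ (×-distrib-+ x y (length (Stabiliser S)))) (distribˡ orientation _ _))
               (RowPreserving Z) sgn ⟩
        orientation * (length (Stabiliser S) · ∑ (RowPreserving Z) sgn) ∎

      orientation-±1 : ∀ x → orientation * x ≈ x ⊎ orientation * x ≈ - x
      orientation-±1 x with -1^-±1 (inversions α Nat.+ inversions β)
      ... | inj₁ s≈1  = inj₁ (trans (*-congʳ (trans (sym (^-homo-* (- 1#) (inversions α) (inversions β))) s≈1)) (*-identityˡ x))
      ... | inj₂ s≈-1 = inj₂ (trans (*-congʳ (trans (sym (^-homo-* (- 1#) (inversions α) (inversions β))) s≈-1)) (-1*x≈-x x))

-- Passage to the canonical labelling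

coefficient-returning : ∀ {c ℓ} (R : CommutativeRing c ℓ) {n} (μ : Partition n) (S : Filling μ ℕ)
  (T P : BijectiveFilling μ) (π : Permutation′ n) → IsReturning T P π →
  let open CommutativeRing R
      open Polynomials R
      value = length (H S) · ∑ A⟨ π • S ⟩ sgn
  in coefficient (x^ P S) (F T S) ≈ value ⊎ coefficient (x^ P S) (F T S) ≈ - value
coefficient-returning R {n} μ S T P π returns =
  Sum.map (trans formula) (trans formula) (orientation-±1 K sameRows? T P π rows columns S value)
  where
  open CommutativeRing R using (Carrier; _≈_; _*_; trans; reflexive; *-congˡ)
  open Polynomials R using (coefficient; F; _·_; ∑; sgn)
  open Coefficients R {n}
  K = canonical μ

  rows    = proj₁ returns
  columns = proj₂ returns

  value : Carrier
  value = length (H S) · ∑ A⟨ π • S ⟩ sgn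

  H≡ : Stabiliser K sameRows? S ≡ H S
  H≡ = filter-≐ (λ ρ → ≗-dec (Action._▹_ K ρ S) S) (λ ρ → ≗-dec (ρ • S) S)
    (id , id) (rowGroup K)

  ▹≡• : ∀ τ (Z : Filling μ ℕ) → Action._▹_ K τ Z ≡ τ • Z
  ▹≡• τ Z = ≡.refl

  A≡ : (Z : Filling μ ℕ) → A⟨ Z ⟩ ≡ RowPreserving K sameRows? Z
  A≡ Z = filter-RowPreserving K sameRows? _ Z (λ τ → mk⇔ (to τ) (from τ))
    where
    to : ∀ τ → SameRows (τ • Z) Z → SameRows (Action._▹_ K τ Z) Z
    to τ = subst (λ Y → SameRows {μ = μ} Y Z) (≡.sym (▹≡• τ Z))
    from : ∀ τ → SameRows (Action._▹_ K τ Z) Z → SameRows (τ • Z) Z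
    from τ = subst (λ Y → SameRows {μ = μ} Y Z) (▹≡• τ Z)

  RowPreserving≡A : ∀ {Y Z : Filling μ ℕ} → Y ≡ Z → RowPreserving K sameRows? Y ≡ A⟨ Z ⟩
  RowPreserving≡A {Y} ≡.refl = ≡.sym (A≡ Y)

  A-returning≡ : RowPreserving K sameRows? (Action._▹_ K π S) ≡ A⟨ π • S ⟩
  A-returning≡ = RowPreserving≡A {Action._▹_ K π S} {π • S} (▹≡• π S)

  formula : coefficient (x^ P S) (F T S) ≈ orientation K sameRows? T P π rows columns S * value
  formula = trans (coefficient-snaking K sameRows? T P π rows columns S)
    (*-congˡ (reflexive (cong₂ (λ h a → length h · ∑ a sgn) H≡ A-returning≡)))

-- The witnesses of unique existence are returning, for any name g given to them.
chosen-returns : {μ : Partition n} (T P : BijectiveFilling μ) {X : Set}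
  (f : X → ∃! _≈ₚ_ (IsReturning T P)) (g : X → Permutation′ n) →
  (λ x → proj₁ (f x)) ≡ g → ∀ x → IsReturning T P (g x)
chosen-returns T P f g ≡.refl x = proj₁ (proj₂ (f x))

returning-returns : {μ : Partition n} (T P : BijectiveFilling μ) (snaking : IsSnaking T P) →
  IsReturning T P (returning T P snaking)
returning-returns T P = chosen-returns T P (∃!-returning T P) (returning T P) ≡.refl

-- The formula for a family of returning permutations.  Proofs of the snaking
-- property play the role of the index x; as x is arbitrary here, those proofs
-- never have to be compared with one another.
coefficient-returning-family : ∀ {c ℓ} (R : CommutativeRing c ℓ) {n} (μ : Partition n)
  (S : Filling μ ℕ) (T P : BijectiveFilling μ)
  {X : Set} (r : X → Permutation′ n) → (∀ x → IsReturning T P (r x)) → (x : X) →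
  let open CommutativeRing R
      open Polynomials R
      value = length (H S) · ∑ A⟨ r x • S ⟩ sgn
  in coefficient (x^ P S) (F T S) ≈ value ⊎ coefficient (x^ P S) (F T S) ≈ - value
coefficient-returning-family R μ S T P r r-returns x =
  coefficient-returning R μ S T P (r x) (r-returns x)

theorem1p12 : ∀ {c ℓ} (R : CommutativeRing c ℓ) {n} (μ : Partition n) (S : Filling μ ℕ) (T : SYT μ)
    (P : BijectiveFilling μ) (snaking : IsSnaking (SYT.filling T) P) →
    let open CommutativeRing R
        open Polynomials R
        π = returning (SYT.filling T) P snaking
        value = length (H S) · ∑ A⟨ π • S ⟩ sgn
    in coefficient (x^ P S) (F (SYT.filling T) S) ≈ value
       ⊎ coefficient (x^ P S) (F (SYT.filling T) S) ≈ - value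
theorem1p12 R μ S T P = coefficient-returning-family R μ S (SYT.filling T) P
  (returning (SYT.filling T) P) (returning-returns (SYT.filling T) P)
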